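{- A sentence $F\leftrightarrow G$ over the signature $\sigma_2$ is provable in $\mathit{HT}_{\#}$ if and only if $\gamma F \leftrightarrow \gamma G$ is provable in the classical first-order theory $\mathit{HT}_{\#}'$.
   Context: $\sigma_2$ is the two-sorted signature (general, integer) with numerals, other precomputed terms, integer arithmetic, predicates $p/n$, comparisons $=,\neq,<,>,\leq,\geq$, and predicate constants $\mathit{Atleast}^{\mathbf{X};\mathbf{V}}_F$, $\mathit{Atmost}^{\mathbf{X};\mathbf{V}}_F$, $\mathit{Start}^{\mathbf{X};\mathbf{V}}_F$. $\mathit{HT}_{\#}$ is first-order intuitionistic logic over $\sigma_2$ extended by $F\lor(F\to G)\lor\neg G$, $\exists X(F\to\forall XF)$, and the axioms Std (sentences without $p/n$ and without Atleast/Atmost/Start true in the standard interpretation), Ind (induction schema over nonnegative integers), $D_0$ (recursive definition of Start) and $D_1$ (definitions of Atleast and Atmost in terms of Start). $\sigma_2'$ is $\sigma_2$ plus, for every predicate symbol $p$ other than comparisons, a new symbol $p'$ of the same arity; $F'$ replaces each such $p$ by $p'$; $\mathcal{A}$ is the set of formulas $\forall\mathbf{X}(p(\mathbf{X})\to p'(\mathbf{X}))$. $\gamma$ is defined by: $\gamma F=F$ for atomic $F$; $\gamma(\neg F)=\neg F'$; $\gamma$ commutes with $\land,\lor,\forall,\exists$; $\gamma(F\to G)=(\gamma F\to\gamma G)\land(F'\to G')$. $\mathit{HT}_{\#}'$ is the classical first-order theory over $\sigma_2'$ with axioms $\mathcal{A}$, $\gamma(\mathrm{Ind})$, Std, $\gamma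 D_0$, $\gamma D_1$. -}

module Defs where

open import Level using (0ℓ)
open import Data.Empty using (⊥)
open import Data.Nat.Base using (ℕ; zero; suc)
open import Data.Integer.Base as ℤ using (ℤ; +_)
open import Data.List.Base using (List; []; _∷_; _++_; map; replicate)
open import Data.List.Membership.Propositional using (_∈_)
open import Data.List.Membership.Propositional.Properties using (∈-++⁺ˡ; ∈-++⁺ʳ)
open import Data.List.Relation.Binary.Subset.Propositional using (_⊆_)
open import Data.List.Relation.Unary.All as All using (All; []; _∷_)
open import Data.List.Relation.Unary.All.Properties using (++⁺)
open import Data.List.Relation.Unary.Any using (here; there)
open import Data.Product.Base using (_×_)
open import Function.Base using (_∘_; id)
open import Function.Bundles using (_⇔_; _↔_)
open import Relation.Binary.Core using (Rel)
open import Relation.Binary.PropositionalEquality.Core using (_≡_; refl)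
open import Relation.Binary.Structures using (IsTotalOrder)
open import Relation.Nullary.Negation.Core using (¬_)

data Constant (Symbol : Set) : Set where
  symbolic : Symbol → Constant Symbol
  inf sup  : Constant Symbol

data Precomputed (Symbol : Set) : Set where
  numeral : ℤ → Precomputed Symbol
  other   : Constant Symbol → Precomputed Symbol

record Vocabulary : Set₁ where
  field
    Symbol        : Set
    enumeration   : Symbol ↔ ℕ
    _≼_           : Rel (Precomputed Symbol) 0ℓ
    isTotalOrder  : IsTotalOrder _≡_ _≼_
    inf-least     : ∀ t → other inf ≼ t
    sup-greatest  : ∀ t → t ≼ other sup
    numeral-order : ∀ m n → (numeral m ≼ numeral n) ⇔ (m ℤ.≤ n)

data Sort : Set where
  gen int : Sort

Cxt : Set
Cxt = List Sort

gens : ℕ → Cxt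
gens n = replicate n gen

-- Predicate constants, indexed by the sorts of their arguments.
Signature : Set₁
Signature = List Sort → Set

data Cmp : Set where
  eq ne lt gt le ge : Cmp

module Language (𝒱 : Vocabulary) where

  open Vocabulary 𝒱

  -- Variables are de Bruijn indices.  The constructor ↑_ makes int a subsort
  -- of gen; a numeral is an int-term, so only the remaining precomputed terms
  -- are gen-constants.
  data Term (Δ : Cxt) : Sort → Set where
    var         : ∀ {s} → s ∈ Δ → Term Δ s
    num         : ℤ → Term Δ int
    const       : Constant Symbol → Term Δ gen
    ↑_          : Term Δ int → Term Δ gen
    _⊕_ _⊖_ _⊗_ : Term Δ int → Term Δ int → Term Δ int

  infix 25 ↑_

  Args : Cxt → List Sort → Set
  Args Δ = All (Term Δ)

  asGeneral : ∀ {Δ} s → Term Δ s → Term Δ gen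
  asGeneral gen t = t
  asGeneral int t = ↑ t

  infixr 9 ¬ᶠ_
  infixr 7 _∧ᶠ_
  infixr 6 _∨ᶠ_
  infixr 5 _⇒ᶠ_
  infix  4 _⇔ᶠ_

  data Formula (P : Signature) (Δ : Cxt) : Set where
    atom           : ∀ {ar} → P ar → Args Δ ar → Formula P Δ
    cmp            : Cmp → Term Δ gen → Term Δ gen → Formula P Δ
    ⊥ᶠ             : Formula P Δ
    ¬ᶠ_            : Formula P Δ → Formula P Δ
    _∧ᶠ_ _∨ᶠ_ _⇒ᶠ_ : Formula P Δ → Formula P Δ → Formula P Δ
    ∀ᶠ ∃ᶠ          : (s : Sort) → Formula P (s ∷ Δ) → Formula P Δ

  Sentence : Signature → Set
  Sentence P = Formula P []

  _⇔ᶠ_ : ∀ {P Δ} → Formula P Δ → Formula P Δ → Formula P Δ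
  F ⇔ᶠ G = (F ⇒ᶠ G) ∧ᶠ (G ⇒ᶠ F)

  Subst : Cxt → Cxt → Set
  Subst Δ Θ = ∀ {s} → s ∈ Δ → Term Θ s

  liftRen : ∀ {Δ Θ : Cxt} {s} → Δ ⊆ Θ → (s ∷ Δ) ⊆ (s ∷ Θ)
  liftRen ρ (here p)  = here p
  liftRen ρ (there i) = there (ρ i)

  renTerm : ∀ {Δ Θ s} → Δ ⊆ Θ → Term Δ s → Term Θ s
  renTerm ρ (var i)   = var (ρ i)
  renTerm ρ (num z)   = num z
  renTerm ρ (const c) = const c
  renTerm ρ (↑ t)     = ↑ renTerm ρ t
  renTerm ρ (t ⊕ u)   = renTerm ρ t ⊕ renTerm ρ u
  renTerm ρ (t ⊖ u)   = renTerm ρ t ⊖ renTerm ρ u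
  renTerm ρ (t ⊗ u)   = renTerm ρ t ⊗ renTerm ρ u

  ren : ∀ {P Δ Θ} → Δ ⊆ Θ → Formula P Δ → Formula P Θ
  ren ρ (atom p ts)  = atom p (All.map (renTerm ρ) ts)
  ren ρ (cmp c t u)  = cmp c (renTerm ρ t) (renTerm ρ u)
  ren ρ ⊥ᶠ           = ⊥ᶠ
  ren ρ (¬ᶠ F)       = ¬ᶠ ren ρ F
  ren ρ (F ∧ᶠ G)     = ren ρ F ∧ᶠ ren ρ G
  ren ρ (F ∨ᶠ G)     = ren ρ F ∨ᶠ ren ρ G
  ren ρ (F ⇒ᶠ G)     = ren ρ F ⇒ᶠ ren ρ G
  ren ρ (∀ᶠ s F)     = ∀ᶠ s (ren (liftRen ρ) F)
  ren ρ (∃ᶠ s F)     = ∃ᶠ s (ren (liftRen ρ) F)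

  wk : ∀ {P Δ s} → Formula P Δ → Formula P (s ∷ Δ)
  wk = ren there

  wkSentence : ∀ {P Δ} → Sentence P → Formula P Δ
  wkSentence = ren (λ ())

  liftSub : ∀ {Δ Θ s} → Subst Δ Θ → Subst (s ∷ Δ) (s ∷ Θ)
  liftSub σ (here p)  = var (here p)
  liftSub σ (there i) = renTerm there (σ i)

  subTerm : ∀ {Δ Θ s} → Subst Δ Θ → Term Δ s → Term Θ s
  subTerm σ (var i)   = σ i
  subTerm σ (num z)   = num z
  subTerm σ (const c) = const c
  subTerm σ (↑ t)     = ↑ subTerm σ t
  subTerm σ (t ⊕ u)   = subTerm σ t ⊕ subTerm σ u
  subTerm σ (t ⊖ u)   = subTerm σ t ⊖ subTerm σ u
  subTerm σ (t ⊗ u)   = subTerm σ t ⊗ subTerm σ u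

  sub : ∀ {P Δ Θ} → Subst Δ Θ → Formula P Δ → Formula P Θ
  sub σ (atom p ts)  = atom p (All.map (subTerm σ) ts)
  sub σ (cmp c t u)  = cmp c (subTerm σ t) (subTerm σ u)
  sub σ ⊥ᶠ           = ⊥ᶠ
  sub σ (¬ᶠ F)       = ¬ᶠ sub σ F
  sub σ (F ∧ᶠ G)     = sub σ F ∧ᶠ sub σ G
  sub σ (F ∨ᶠ G)     = sub σ F ∨ᶠ sub σ G
  sub σ (F ⇒ᶠ G)     = sub σ F ⇒ᶠ sub σ G
  sub σ (∀ᶠ s F)     = ∀ᶠ s (sub (liftSub σ) F)
  sub σ (∃ᶠ s F)     = ∃ᶠ s (sub (liftSub σ) F)

  instantiate : ∀ {Δ s} → Term Δ s → Subst (s ∷ Δ) Δ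
  instantiate t (here refl) = t
  instantiate t (there i)   = var i

  _[_] : ∀ {P Δ s} → Formula P (s ∷ Δ) → Term Δ s → Formula P Δ
  F [ t ] = sub (instantiate t) F

  mapPred : ∀ {P Q : Signature} {Δ} → (∀ {ar} → P ar → Q ar) → Formula P Δ → Formula Q Δ
  mapPred h (atom p ts)  = atom (h p) ts
  mapPred h (cmp c t u)  = cmp c t u
  mapPred h ⊥ᶠ           = ⊥ᶠ
  mapPred h (¬ᶠ F)       = ¬ᶠ mapPred h F
  mapPred h (F ∧ᶠ G)     = mapPred h F ∧ᶠ mapPred h G
  mapPred h (F ∨ᶠ G)     = mapPred h F ∨ᶠ mapPred h G
  mapPred h (F ⇒ᶠ G)     = mapPred h F ⇒ᶠ mapPred h G
  mapPred h (∀ᶠ s F)     = ∀ᶠ s (mapPred h F)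
  mapPred h (∃ᶠ s F)     = ∃ᶠ s (mapPred h F)

  ∀-closure : ∀ {P Δ} → Formula P Δ → Sentence P
  ∀-closure {Δ = []}    F = F
  ∀-closure {Δ = s ∷ Δ} F = ∀-closure (∀ᶠ s F)

  ∀* ∃* : ∀ {P Δ} (Ξ : Cxt) → Formula P (Ξ ++ Δ) → Formula P Δ
  ∀* []      F = F
  ∀* (s ∷ Ξ) F = ∀* Ξ (∀ᶠ s F)
  ∃* []      F = F
  ∃* (s ∷ Ξ) F = ∃* Ξ (∃ᶠ s F)

  vars : ∀ {Δ} {Ξ : Cxt} → Ξ ⊆ Δ → Args Δ Ξ
  vars ρ = All.tabulate (var ∘ ρ)

  -- p/n for every symbolic constant p and every n.
  data Pred₀ : Signature where
    _/_ : Symbol → (n : ℕ) → Pred₀ (gens n)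

  -- The superscript lists X and V are represented by their lengths k and v;
  -- the free variables of F are X (indices below k) followed by V.
  data Pred₂ : Signature where
    base    : ∀ {ar} → Pred₀ ar → Pred₂ ar
    atleast : ∀ k v → Formula Pred₀ (gens k ++ gens v) → Pred₂ (gens v ++ gen ∷ [])
    atmost  : ∀ k v → Formula Pred₀ (gens k ++ gens v) → Pred₂ (gens v ++ gen ∷ [])
    start   : ∀ k v → Formula Pred₀ (gens k ++ gens v) →
              Pred₂ (gens k ++ gens v ++ int ∷ [])

  σ₂ : Signature
  σ₂ = Pred₂

  -- Intuitionistic natural deduction with equality.  The open formulas in Ax
  -- are axioms, so that each stands for its universal closure.

  Axioms : Signature → Set₁
  Axioms P = ∀ {Δ} → Formula P Δ → Set

  infix 3 _∣_⊢_ _⊢_ _⊢ᶜ_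

  data _∣_⊢_ {P : Signature} (Ax : Axioms P) {Δ : Cxt}
             (Γ : List (Formula P Δ)) : Formula P Δ → Set where
    axiom : ∀ {F} → Ax F → Ax ∣ Γ ⊢ F
    hyp   : ∀ {F} → F ∈ Γ → Ax ∣ Γ ⊢ F
    ⊥E    : ∀ {F} → Ax ∣ Γ ⊢ ⊥ᶠ → Ax ∣ Γ ⊢ F
    ¬I    : ∀ {F} → Ax ∣ F ∷ Γ ⊢ ⊥ᶠ → Ax ∣ Γ ⊢ ¬ᶠ F
    ¬E    : ∀ {F} → Ax ∣ Γ ⊢ ¬ᶠ F → Ax ∣ Γ ⊢ F → Ax ∣ Γ ⊢ ⊥ᶠ
    ∧I    : ∀ {F G} → Ax ∣ Γ ⊢ F → Ax ∣ Γ ⊢ G → Ax ∣ Γ ⊢ F ∧ᶠ G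
    ∧E₁   : ∀ {F G} → Ax ∣ Γ ⊢ F ∧ᶠ G → Ax ∣ Γ ⊢ F
    ∧E₂   : ∀ {F G} → Ax ∣ Γ ⊢ F ∧ᶠ G → Ax ∣ Γ ⊢ G
    ∨I₁   : ∀ {F G} → Ax ∣ Γ ⊢ F → Ax ∣ Γ ⊢ F ∨ᶠ G
    ∨I₂   : ∀ {F G} → Ax ∣ Γ ⊢ G → Ax ∣ Γ ⊢ F ∨ᶠ G
    ∨E    : ∀ {F G H} → Ax ∣ Γ ⊢ F ∨ᶠ G → Ax ∣ F ∷ Γ ⊢ H → Ax ∣ G ∷ Γ ⊢ H → Ax ∣ Γ ⊢ H
    ⇒I    : ∀ {F G} → Ax ∣ F ∷ Γ ⊢ G → Ax ∣ Γ ⊢ F ⇒ᶠ G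
    ⇒E    : ∀ {F G} → Ax ∣ Γ ⊢ F ⇒ᶠ G → Ax ∣ Γ ⊢ F → Ax ∣ Γ ⊢ G
    ∀I    : ∀ {s F} → Ax ∣ map wk Γ ⊢ F → Ax ∣ Γ ⊢ ∀ᶠ s F
    ∀E    : ∀ {s F} → Ax ∣ Γ ⊢ ∀ᶠ s F → (t : Term Δ s) → Ax ∣ Γ ⊢ F [ t ]
    ∃I    : ∀ {s F} (t : Term Δ s) → Ax ∣ Γ ⊢ F [ t ] → Ax ∣ Γ ⊢ ∃ᶠ s F
    ∃E    : ∀ {s F G} → Ax ∣ Γ ⊢ ∃ᶠ s F → Ax ∣ F ∷ map wk Γ ⊢ wk G → Ax ∣ Γ ⊢ G
    ≈refl : (t : Term Δ gen) → Ax ∣ Γ ⊢ cmp eq t t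
    ≈subst : ∀ {s} (F : Formula P (s ∷ Δ)) {t u : Term Δ s} →
             Ax ∣ Γ ⊢ cmp eq (asGeneral s t) (asGeneral s u) →
             Ax ∣ Γ ⊢ F [ t ] → Ax ∣ Γ ⊢ F [ u ]

  _⊢_ : ∀ {P} → Axioms P → Sentence P → Set
  Ax ⊢ F = Ax ∣ [] ⊢ F

  data Classical {P : Signature} (Ax : Axioms P) : Axioms P where
    proper          : ∀ {Δ} {F : Formula P Δ} → Ax F → Classical Ax F
    excluded-middle : ∀ {Δ} (F : Formula P Δ) → Classical Ax (F ∨ᶠ ¬ᶠ F)

  _⊢ᶜ_ : ∀ {P} → Axioms P → Sentence P → Set
  Ax ⊢ᶜ F = Classical Ax ⊢ F

  NoPred : Signature
  NoPred _ = ⊥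

  Dom : Sort → Set
  Dom gen = Precomputed Symbol
  Dom int = ℤ

  Env : Cxt → Set
  Env = All Dom

  ⟦_⟧ᵗ : ∀ {Δ s} → Term Δ s → Env Δ → Dom s
  ⟦ var i ⟧ᵗ   e = All.lookup e i
  ⟦ num z ⟧ᵗ   e = z
  ⟦ const c ⟧ᵗ e = other c
  ⟦ ↑ t ⟧ᵗ     e = numeral (⟦ t ⟧ᵗ e)
  ⟦ t ⊕ u ⟧ᵗ   e = ⟦ t ⟧ᵗ e ℤ.+ ⟦ u ⟧ᵗ e
  ⟦ t ⊖ u ⟧ᵗ   e = ⟦ t ⟧ᵗ e ℤ.- ⟦ u ⟧ᵗ e
  ⟦ t ⊗ u ⟧ᵗ   e = ⟦ t ⟧ᵗ e ℤ.* ⟦ u ⟧ᵗ e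

  ⟦_⟧ᶜ : Cmp → Rel (Precomputed Symbol) 0ℓ
  ⟦ eq ⟧ᶜ x y = x ≡ y
  ⟦ ne ⟧ᶜ x y = ¬ (x ≡ y)
  ⟦ lt ⟧ᶜ x y = x ≼ y × ¬ (x ≡ y)
  ⟦ gt ⟧ᶜ x y = y ≼ x × ¬ (y ≡ x)
  ⟦ le ⟧ᶜ x y = x ≼ y
  ⟦ ge ⟧ᶜ x y = y ≼ x

  -- Truth in the standard interpretation is classical truth: ∨ and ∃ are
  -- defined by De Morgan duality, so that every classically valid sentence is
  -- true without assuming excluded middle in Agda.
  ⟦_⟧ : ∀ {Δ} → Formula NoPred Δ → Env Δ → Set
  ⟦ cmp c t u ⟧ e = ⟦ c ⟧ᶜ (⟦ t ⟧ᵗ e) (⟦ u ⟧ᵗ e)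
  ⟦ ⊥ᶠ ⟧        e = ⊥
  ⟦ ¬ᶠ F ⟧      e = ¬ ⟦ F ⟧ e
  ⟦ F ∧ᶠ G ⟧    e = ⟦ F ⟧ e × ⟦ G ⟧ e
  ⟦ F ∨ᶠ G ⟧    e = ¬ (¬ ⟦ F ⟧ e × ¬ ⟦ G ⟧ e)
  ⟦ F ⇒ᶠ G ⟧    e = ⟦ F ⟧ e → ⟦ G ⟧ e
  ⟦ ∀ᶠ s F ⟧    e = (d : Dom s) → ⟦ F ⟧ (d ∷ e)
  ⟦ ∃ᶠ s F ⟧    e = ¬ ((d : Dom s) → ¬ ⟦ F ⟧ (d ∷ e))

  data Std {P : Signature} : Sentence P → Set where
    std : (S : Sentence NoPred) → ⟦ S ⟧ [] → Std (mapPred (λ ()) S)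

  lex : ∀ {Δ} k → Args Δ (gens k) → Args Δ (gens k) → Formula σ₂ Δ
  lex zero          []       []       = ⊥ᶠ
  lex (suc zero)    (x ∷ []) (y ∷ []) = cmp lt x y
  lex (suc (suc k)) (x ∷ xs) (y ∷ ys) = cmp lt x y ∨ᶠ (cmp eq x y ∧ᶠ lex (suc k) xs ys)

  module Counting (k v : ℕ) (F : Formula Pred₀ (gens k ++ gens v)) where

    X V : Cxt
    X = gens k
    V = gens v

    Start : ∀ {Δ} → Args Δ X → Args Δ V → Term Δ int → Formula σ₂ Δ
    Start xs vs n = atom (start k v F) (++⁺ xs (++⁺ vs (n ∷ [])))

    Atleast Atmost : ∀ {Δ} → Args Δ V → Term Δ gen → Formula σ₂ Δ
    Atleast vs y = atom (atleast k v F) (++⁺ vs (y ∷ []))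
    Atmost  vs y = atom (atmost k v F) (++⁺ vs (y ∷ []))

    -- ∀ X V N (N ≤ 0 → Start(X,V,N))
    start≤0 : Sentence σ₂
    start≤0 = ∀-closure {Δ = int ∷ X ++ V} (cmp le (↑ N) (↑ num (+ 0)) ⇒ᶠ Start xs vs N)
      where
      xs = vars (there ∘ ∈-++⁺ˡ)
      vs = vars (there ∘ ∈-++⁺ʳ X)
      N  = var (here refl)

    -- ∀ X V (Start(X,V,1) ↔ F)
    start-1 : Sentence σ₂
    start-1 = ∀-closure {Δ = X ++ V} (Start xs vs (num (+ 1)) ⇔ᶠ mapPred base F)
      where
      xs = vars ∈-++⁺ˡ
      vs = vars (∈-++⁺ʳ X)

    -- ∀ X V N (N > 0 → (Start(X,V,N+1) ↔ F ∧ ∃ U (X < U ∧ Start(U,V,N))))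
    start-suc : Sentence σ₂
    start-suc = ∀-closure {Δ = int ∷ X ++ V}
      (cmp gt (↑ N) (↑ num (+ 0)) ⇒ᶠ
        (Start (xs id) (vs id) (N ⊕ num (+ 1)) ⇔ᶠ
          wk (mapPred base F) ∧ᶠ
          ∃* X (lex k (xs (∈-++⁺ʳ X)) us ∧ᶠ Start us (vs (∈-++⁺ʳ X)) N′)))
      where
      xs : ∀ {Δ} → (int ∷ X ++ V) ⊆ Δ → Args Δ X
      xs ρ = vars (λ i → ρ (there (∈-++⁺ˡ i)))
      vs : ∀ {Δ} → (int ∷ X ++ V) ⊆ Δ → Args Δ V
      vs ρ = vars (λ i → ρ (there (∈-++⁺ʳ X i)))
      us : Args (X ++ int ∷ X ++ V) X
      us = vars ∈-++⁺ˡ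
      N : Term (int ∷ X ++ V) int
      N = var (here refl)
      N′ : Term (X ++ int ∷ X ++ V) int
      N′ = var (∈-++⁺ʳ X (here refl))

    -- Below, the context is V,Y or, under the inner quantifiers, N,X,V,Y.
    private
      vs : Args (V ++ gen ∷ []) V
      vs = vars ∈-++⁺ˡ
      Y : Term (V ++ gen ∷ []) gen
      Y = var (∈-++⁺ʳ V (here refl))
      N : Term (int ∷ X ++ V ++ gen ∷ []) int
      N = var (here refl)
      xs′ : Args (int ∷ X ++ V ++ gen ∷ []) X
      xs′ = vars (there ∘ ∈-++⁺ˡ)
      vs′ : Args (int ∷ X ++ V ++ gen ∷ []) V
      vs′ = vars (λ i → there (∈-++⁺ʳ X (∈-++⁺ˡ i)))
      Y′ : Term (int ∷ X ++ V ++ gen ∷ []) gen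
      Y′ = var (there (∈-++⁺ʳ X (∈-++⁺ʳ V (here refl))))

    -- ∀ V Y (Atleast(V,Y) ↔ ∃ X N (Start(X,V,N) ∧ N ≥ Y))
    atleast-def : Sentence σ₂
    atleast-def = ∀-closure
      (Atleast vs Y ⇔ᶠ ∃* X (∃ᶠ int (Start xs′ vs′ N ∧ᶠ cmp ge (↑ N) Y′)))

    -- ∀ V Y (Atmost(V,Y) ↔ ∀ X N (Start(X,V,N) → N ≤ Y))
    atmost-def : Sentence σ₂
    atmost-def = ∀-closure
      (Atmost vs Y ⇔ᶠ ∀* X (∀ᶠ int (Start xs′ vs′ N ⇒ᶠ cmp le (↑ N) Y′)))

  data D₀ : Sentence σ₂ → Set where
    d₀-≤0  : ∀ k v F → D₀ (Counting.start≤0 k v F)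
    d₀-1   : ∀ k v F → D₀ (Counting.start-1 k v F)
    d₀-suc : ∀ k v F → D₀ (Counting.start-suc k v F)

  data D₁ : Sentence σ₂ → Set where
    d₁-atleast : ∀ k v F → D₁ (Counting.atleast-def k v F)
    d₁-atmost  : ∀ k v F → D₁ (Counting.atmost-def k v F)

  -- F[0] ∧ ∀ N (N ≥ 0 ∧ F → F[N+1]) → ∀ N (N ≥ 0 → F)
  induction : ∀ {P Δ} → Formula P (int ∷ Δ) → Formula P Δ
  induction {P} {Δ} F =
    F [ num (+ 0) ] ∧ᶠ ∀ᶠ int (N≥0 ∧ᶠ F ⇒ᶠ sub N↦N+1 F) ⇒ᶠ ∀ᶠ int (N≥0 ⇒ᶠ F)
    where
    N : Term (int ∷ Δ) int
    N = var (here refl)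
    N≥0 : Formula P (int ∷ Δ)
    N≥0 = cmp ge (↑ N) (↑ num (+ 0))
    N↦N+1 : Subst (int ∷ Δ) (int ∷ Δ)
    N↦N+1 (here refl) = N ⊕ num (+ 1)
    N↦N+1 (there i)   = var (there i)

  data Ind : Axioms σ₂ where
    ind : ∀ {Δ} (F : Formula σ₂ (int ∷ Δ)) → Ind (induction F)

  data HT♯ : Axioms σ₂ where
    hosoi : ∀ {Δ} (F G : Formula σ₂ Δ) → HT♯ (F ∨ᶠ (F ⇒ᶠ G) ∨ᶠ ¬ᶠ G)
    sqht  : ∀ {Δ} s (F : Formula σ₂ (s ∷ Δ)) → HT♯ (∃ᶠ s (F ⇒ᶠ wk (∀ᶠ s F)))
    std   : ∀ {Δ S} → Std S → HT♯ {Δ} (wkSentence S)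
    ind   : ∀ {Δ} {F : Formula σ₂ Δ} → Ind F → HT♯ F
    d₀    : ∀ {Δ S} → D₀ S → HT♯ {Δ} (wkSentence S)
    d₁    : ∀ {Δ S} → D₁ S → HT♯ {Δ} (wkSentence S)

  data Primed (P : Signature) : Signature where
    plain prime : ∀ {ar} → P ar → Primed P ar

  σ₂′ : Signature
  σ₂′ = Primed σ₂

  _′ : ∀ {P Δ} → Formula P Δ → Formula (Primed P) Δ
  _′ = mapPred prime

  γ : ∀ {P Δ} → Formula P Δ → Formula (Primed P) Δ
  γ (atom p ts) = atom (plain p) ts
  γ (cmp c t u) = cmp c t u
  γ ⊥ᶠ          = ⊥ᶠ
  γ (¬ᶠ F)      = ¬ᶠ (F ′)
  γ (F ∧ᶠ G)    = γ F ∧ᶠ γ G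
  γ (F ∨ᶠ G)    = γ F ∨ᶠ γ G
  γ (F ⇒ᶠ G)    = (γ F ⇒ᶠ γ G) ∧ᶠ ((F ′) ⇒ᶠ (G ′))
  γ (∀ᶠ s F)    = ∀ᶠ s (γ F)
  γ (∃ᶠ s F)    = ∃ᶠ s (γ F)

  -- ∀ X (p(X) → p′(X))
  data 𝒜 : Sentence σ₂′ → Set where
    persistence : ∀ {ar} (p : σ₂ ar) →
                  𝒜 (∀-closure {Δ = ar} (atom (plain p) (vars id) ⇒ᶠ atom (prime p) (vars id)))

  data HT♯′ : Axioms σ₂′ where
    pers : ∀ {Δ S} → 𝒜 S → HT♯′ {Δ} (wkSentence S)
    γind : ∀ {Δ} {F : Formula σ₂ Δ} → Ind F → HT♯′ (γ F)
    std  : ∀ {Δ S} → Std S → HT♯′ {Δ} (wkSentence S)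
    γd₀  : ∀ {Δ S} → D₀ S → HT♯′ {Δ} (wkSentence (γ S))
    γd₁  : ∀ {Δ S} → D₁ S → HT♯′ {Δ} (wkSentence (γ S))

-- γ embeds HT♯ into HT♯′ because persistence yields γ F → F′.  Conversely, a
-- classical derivation of γ F → γ G is read twice inside HT♯ + F, under a
-- translation N relative to C = G in which ⊥ becomes C, atoms become p ∨ C and
-- p′ becomes ¬¬p ∨ C.  Then ¬¬A ⊢ N(A′) ⊢ ¬¬A ∨ C and A ⊢ N(γ A) ⊢ A ∨ C for
-- all A, by hosoi and sqht.  Reading first with p′ in place of p makes excluded
-- middle valid, since all formulas become doubly negated, and gives ¬¬G.
-- Once ¬¬C is known, hosoi gives A ∨ (A → C), which is excluded middle under N,
-- so that the derivation itself can be read and gives G.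

module Submission where

open import Defs
open import Data.Integer.Base using (+_)
open import Data.List.Base using (List; []; _∷_; map)
open import Data.List.Membership.Propositional using (_∈_)
open import Data.List.Membership.Propositional.Properties using (∈-map⁺)
open import Data.List.Properties using (map-∘; map-cong)
open import Data.List.Relation.Binary.Subset.Propositional using (_⊆_)
open import Data.List.Relation.Binary.Subset.Propositional.Properties using (∷⁺ʳ; map⁺)
open import Data.List.Relation.Unary.All as All using (All; []; _∷_)
open import Data.List.Relation.Unary.All.Properties as All using ()
open import Data.List.Relation.Unary.Any using (here; there)
open import Data.Product.Base using (_,_)
open import Function.Base using (id)
open import Function.Bundles using (_⇔_; mk⇔)
open import Relation.Binary.PropositionalEquality
  using (_≡_; refl; sym; trans; cong; cong₂; subst)

module Calculus (𝒱 : Vocabulary) where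

  open Language 𝒱

  -- Substitution

  module _ {Δ Θ : Cxt} where

    -- Renamings are handled as substitutions by variables, so that the mixed composition laws below
    -- reduce to `subTerm-subTerm` and `sub-sub`. The hypothesis is pointwise because `liftSub` and
    -- `liftRen` agree only pointwise.
    renTerm-asSub : {ρ : Δ ⊆ Θ} {σ : Subst Δ Θ} → (∀ {s} (i : s ∈ Δ) → σ i ≡ var (ρ i)) →
                    ∀ {s} (t : Term Δ s) → subTerm σ t ≡ renTerm ρ t
    renTerm-asSub e (var i)   = e i
    renTerm-asSub e (num z)   = refl
    renTerm-asSub e (const c) = refl
    renTerm-asSub e (↑ t)     = cong ↑_ (renTerm-asSub e t)
    renTerm-asSub e (t ⊕ u)   = cong₂ _⊕_ (renTerm-asSub e t) (renTerm-asSub e u)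
    renTerm-asSub e (t ⊖ u)   = cong₂ _⊖_ (renTerm-asSub e t) (renTerm-asSub e u)
    renTerm-asSub e (t ⊗ u)   = cong₂ _⊗_ (renTerm-asSub e t) (renTerm-asSub e u)

  module _ {P : Signature} where

    ren-asSub : ∀ {Δ Θ} {ρ : Δ ⊆ Θ} {σ : Subst Δ Θ} → (∀ {s} (i : s ∈ Δ) → σ i ≡ var (ρ i)) →
                (F : Formula P Δ) → sub σ F ≡ ren ρ F
    ren-asSub {Δ} {ρ = ρ} {σ} e = go
      where
      lift-e : ∀ {s r} (i : s ∈ r ∷ Δ) → liftSub σ i ≡ var (liftRen ρ i)
      lift-e (here refl) = refl
      lift-e (there i)   = cong (renTerm there) (e i)
      go : (F : Formula P Δ) → sub σ F ≡ ren ρ F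
      go (atom p ts) = cong (atom p) (All.map-cong ts (renTerm-asSub e))
      go (cmp c t u) = cong₂ (cmp c) (renTerm-asSub e t) (renTerm-asSub e u)
      go ⊥ᶠ          = refl
      go (¬ᶠ F)      = cong ¬ᶠ_ (go F)
      go (F ∧ᶠ G)    = cong₂ _∧ᶠ_ (go F) (go G)
      go (F ∨ᶠ G)    = cong₂ _∨ᶠ_ (go F) (go G)
      go (F ⇒ᶠ G)    = cong₂ _⇒ᶠ_ (go F) (go G)
      go (∀ᶠ s F)    = cong (∀ᶠ s) (ren-asSub lift-e F)
      go (∃ᶠ s F)    = cong (∃ᶠ s) (ren-asSub lift-e F)

  subTerm-subTerm : ∀ {Δ Θ Ξ} {σ : Subst Δ Θ} {τ : Subst Θ Ξ} {υ : Subst Δ Ξ} →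
                    (∀ {s} (i : s ∈ Δ) → subTerm τ (σ i) ≡ υ i) →
                    ∀ {s} (t : Term Δ s) → subTerm τ (subTerm σ t) ≡ subTerm υ t
  subTerm-subTerm e (var i)   = e i
  subTerm-subTerm e (num z)   = refl
  subTerm-subTerm e (const c) = refl
  subTerm-subTerm e (↑ t)     = cong ↑_ (subTerm-subTerm e t)
  subTerm-subTerm e (t ⊕ u)   = cong₂ _⊕_ (subTerm-subTerm e t) (subTerm-subTerm e u)
  subTerm-subTerm e (t ⊖ u)   = cong₂ _⊖_ (subTerm-subTerm e t) (subTerm-subTerm e u)
  subTerm-subTerm e (t ⊗ u)   = cong₂ _⊗_ (subTerm-subTerm e t) (subTerm-subTerm e u)

  subTerm-renTerm : ∀ {Δ Θ Ξ} {ρ : Δ ⊆ Θ} {τ : Subst Θ Ξ} {s} (t : Term Δ s) →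
                    subTerm τ (renTerm ρ t) ≡ subTerm (λ i → τ (ρ i)) t
  subTerm-renTerm {τ = τ} t =
    trans (cong (subTerm τ) (sym (renTerm-asSub (λ _ → refl) t))) (subTerm-subTerm (λ _ → refl) t)

  renTerm-subTerm : ∀ {Δ Θ Ξ} {σ : Subst Δ Θ} {ρ : Θ ⊆ Ξ} {s} (t : Term Δ s) →
                    renTerm ρ (subTerm σ t) ≡ subTerm (λ i → renTerm ρ (σ i)) t
  renTerm-subTerm {σ = σ} t =
    trans (sym (renTerm-asSub (λ _ → refl) (subTerm σ t)))
          (subTerm-subTerm (λ i → renTerm-asSub (λ _ → refl) (σ i)) t)

  subTerm-id : ∀ {Δ s} (t : Term Δ s) → subTerm var t ≡ t
  subTerm-id (var i)   = refl
  subTerm-id (num z)   = refl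
  subTerm-id (const c) = refl
  subTerm-id (↑ t)     = cong ↑_ (subTerm-id t)
  subTerm-id (t ⊕ u)   = cong₂ _⊕_ (subTerm-id t) (subTerm-id u)
  subTerm-id (t ⊖ u)   = cong₂ _⊖_ (subTerm-id t) (subTerm-id u)
  subTerm-id (t ⊗ u)   = cong₂ _⊗_ (subTerm-id t) (subTerm-id u)

  subTerm-cong : ∀ {Δ Θ} {σ τ : Subst Δ Θ} → (∀ {s} (i : s ∈ Δ) → σ i ≡ τ i) →
                 ∀ {s} (t : Term Δ s) → subTerm σ t ≡ subTerm τ t
  subTerm-cong {σ = σ} e t =
    trans (sym (subTerm-id (subTerm σ t))) (subTerm-subTerm (λ i → trans (subTerm-id _) (e i)) t)

  module _ {P : Signature} where

    -- The composite is a third substitution `υ` given by pointwise equations, a form that is stable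
    -- under lifting past a quantifier.
    sub-sub : ∀ {Δ Θ Ξ} {σ : Subst Δ Θ} {τ : Subst Θ Ξ} {υ : Subst Δ Ξ} →
              (∀ {s} (i : s ∈ Δ) → subTerm τ (σ i) ≡ υ i) →
              (F : Formula P Δ) → sub τ (sub σ F) ≡ sub υ F
    sub-sub {Δ} {σ = σ} {τ} {υ} e = go
      where
      lift-e : ∀ {s r} (i : s ∈ r ∷ Δ) → subTerm (liftSub τ) (liftSub σ i) ≡ liftSub υ i
      lift-e (here refl) = refl
      lift-e (there i)   =
        trans (subTerm-renTerm (σ i)) (trans (sym (renTerm-subTerm (σ i))) (cong (renTerm there) (e i)))
      go : (F : Formula P Δ) → sub τ (sub σ F) ≡ sub υ F
      go (atom p ts) = cong (atom p) (trans (All.map-∘ ts) (All.map-cong ts (subTerm-subTerm e)))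
      go (cmp c t u) = cong₂ (cmp c) (subTerm-subTerm e t) (subTerm-subTerm e u)
      go ⊥ᶠ          = refl
      go (¬ᶠ F)      = cong ¬ᶠ_ (go F)
      go (F ∧ᶠ G)    = cong₂ _∧ᶠ_ (go F) (go G)
      go (F ∨ᶠ G)    = cong₂ _∨ᶠ_ (go F) (go G)
      go (F ⇒ᶠ G)    = cong₂ _⇒ᶠ_ (go F) (go G)
      go (∀ᶠ s F)    = cong (∀ᶠ s) (sub-sub lift-e F)
      go (∃ᶠ s F)    = cong (∃ᶠ s) (sub-sub lift-e F)

    sub-id : ∀ {Δ} {σ : Subst Δ Δ} → (∀ {s} (i : s ∈ Δ) → σ i ≡ var i) →
             (F : Formula P Δ) → sub σ F ≡ F
    sub-id {Δ} {σ} e = go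
      where
      id-e : ∀ {s} (t : Term Δ s) → subTerm σ t ≡ t
      id-e t = trans (subTerm-cong e t) (subTerm-id t)
      lift-e : ∀ {s r} (i : s ∈ r ∷ Δ) → liftSub σ i ≡ var i
      lift-e (here refl) = refl
      lift-e (there i)   = cong (renTerm there) (e i)
      go : (F : Formula P Δ) → sub σ F ≡ F
      go (atom p ts) = cong (atom p) (trans (All.map-cong ts id-e) (All.map-id ts))
      go (cmp c t u) = cong₂ (cmp c) (id-e t) (id-e u)
      go ⊥ᶠ          = refl
      go (¬ᶠ F)      = cong ¬ᶠ_ (go F)
      go (F ∧ᶠ G)    = cong₂ _∧ᶠ_ (go F) (go G)
      go (F ∨ᶠ G)    = cong₂ _∨ᶠ_ (go F) (go G)
      go (F ⇒ᶠ G)    = cong₂ _⇒ᶠ_ (go F) (go G)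
      go (∀ᶠ s F)    = cong (∀ᶠ s) (sub-id lift-e F)
      go (∃ᶠ s F)    = cong (∃ᶠ s) (sub-id lift-e F)

    sub-ren : ∀ {Δ Θ Ξ} {ρ : Δ ⊆ Θ} {τ : Subst Θ Ξ} (F : Formula P Δ) →
              sub τ (ren ρ F) ≡ sub (λ i → τ (ρ i)) F
    sub-ren {τ = τ} F =
      trans (cong (sub τ) (sym (ren-asSub (λ _ → refl) F))) (sub-sub (λ _ → refl) F)

    ren-ren : ∀ {Δ Θ Ξ} {ρ : Δ ⊆ Θ} {π : Θ ⊆ Ξ} (F : Formula P Δ) →
              ren π (ren ρ F) ≡ ren (λ i → π (ρ i)) F
    ren-ren {ρ = ρ} F =
      trans (sym (ren-asSub (λ _ → refl) (ren ρ F))) (trans (sub-ren F) (ren-asSub (λ _ → refl) F))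

    wk-[] : ∀ {Δ s} {t : Term Δ s} (F : Formula P Δ) → wk F [ t ] ≡ F
    wk-[] F = trans (sub-ren F) (sub-id (λ _ → refl) F)

    liftwk-[var] : ∀ {Δ s} (F : Formula P (s ∷ Δ)) → ren (liftRen there) F [ var (here refl) ] ≡ F
    liftwk-[var] F = trans (sub-ren F) (sub-id (λ { (here refl) → refl ; (there _) → refl }) F)

    sub-wkSentence : ∀ {Δ Θ} {σ : Subst Δ Θ} (S : Sentence P) → sub σ (wkSentence S) ≡ wkSentence S
    sub-wkSentence S = trans (sub-ren S) (ren-asSub (λ ()) S)

    ren-wkSentence : ∀ {Δ Θ} {ρ : Δ ⊆ Θ} (S : Sentence P) → ren ρ (wkSentence S) ≡ wkSentence S
    ren-wkSentence S = trans (ren-ren S) (trans (sym (ren-asSub {σ = λ ()} (λ ()) S)) (ren-asSub (λ ()) S))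

    wkSentence-id : (S : Sentence P) → wkSentence S ≡ S
    wkSentence-id S = trans (sym (ren-asSub {σ = var} (λ ()) S)) (sub-id (λ _ → refl) S)

  module _ {P Q : Signature} {h : ∀ {ar} → P ar → Q ar} where

    mapPred-ren : ∀ {Δ Θ} {ρ : Δ ⊆ Θ} (F : Formula P Δ) → mapPred h (ren ρ F) ≡ ren ρ (mapPred h F)
    mapPred-ren (atom p ts) = refl
    mapPred-ren (cmp c t u) = refl
    mapPred-ren ⊥ᶠ          = refl
    mapPred-ren (¬ᶠ F)      = cong ¬ᶠ_ (mapPred-ren F)
    mapPred-ren (F ∧ᶠ G)    = cong₂ _∧ᶠ_ (mapPred-ren F) (mapPred-ren G)
    mapPred-ren (F ∨ᶠ G)    = cong₂ _∨ᶠ_ (mapPred-ren F) (mapPred-ren G)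
    mapPred-ren (F ⇒ᶠ G)    = cong₂ _⇒ᶠ_ (mapPred-ren F) (mapPred-ren G)
    mapPred-ren (∀ᶠ s F)    = cong (∀ᶠ s) (mapPred-ren F)
    mapPred-ren (∃ᶠ s F)    = cong (∃ᶠ s) (mapPred-ren F)

    mapPred-sub : ∀ {Δ Θ} {σ : Subst Δ Θ} (F : Formula P Δ) → mapPred h (sub σ F) ≡ sub σ (mapPred h F)
    mapPred-sub (atom p ts) = refl
    mapPred-sub (cmp c t u) = refl
    mapPred-sub ⊥ᶠ          = refl
    mapPred-sub (¬ᶠ F)      = cong ¬ᶠ_ (mapPred-sub F)
    mapPred-sub (F ∧ᶠ G)    = cong₂ _∧ᶠ_ (mapPred-sub F) (mapPred-sub G)
    mapPred-sub (F ∨ᶠ G)    = cong₂ _∨ᶠ_ (mapPred-sub F) (mapPred-sub G)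
    mapPred-sub (F ⇒ᶠ G)    = cong₂ _⇒ᶠ_ (mapPred-sub F) (mapPred-sub G)
    mapPred-sub (∀ᶠ s F)    = cong (∀ᶠ s) (mapPred-sub F)
    mapPred-sub (∃ᶠ s F)    = cong (∃ᶠ s) (mapPred-sub F)

    mapPred-∀-closure : ∀ {Δ} (F : Formula P Δ) → mapPred h (∀-closure F) ≡ ∀-closure (mapPred h F)
    mapPred-∀-closure {[]}    F = refl
    mapPred-∀-closure {s ∷ Δ} F = mapPred-∀-closure (∀ᶠ s F)

  -- Natural deduction

  -- Witnesses that no sort is empty, on which `drinker` and the existential case of `efq` rest.
  default : ∀ {Δ} s → Term Δ s
  default gen = const inf
  default int = num (+ 0)

  module _ {P : Signature} {Ax : Axioms P} where

    ⊢-≡ : ∀ {Δ} {Γ : List (Formula P Δ)} {F G} → F ≡ G → Ax ∣ Γ ⊢ F → Ax ∣ Γ ⊢ G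
    ⊢-≡ {Γ = Γ} = subst (Ax ∣ Γ ⊢_)

    weaken : ∀ {Δ} {Γ Γ′ : List (Formula P Δ)} {F} → Γ ⊆ Γ′ → Ax ∣ Γ ⊢ F → Ax ∣ Γ′ ⊢ F
    weaken ρ (axiom a)      = axiom a
    weaken ρ (hyp i)        = hyp (ρ i)
    weaken ρ (⊥E d)         = ⊥E (weaken ρ d)
    weaken ρ (¬I d)         = ¬I (weaken (∷⁺ʳ _ ρ) d)
    weaken ρ (¬E d e)       = ¬E (weaken ρ d) (weaken ρ e)
    weaken ρ (∧I d e)       = ∧I (weaken ρ d) (weaken ρ e)
    weaken ρ (∧E₁ d)        = ∧E₁ (weaken ρ d)
    weaken ρ (∧E₂ d)        = ∧E₂ (weaken ρ d)
    weaken ρ (∨I₁ d)        = ∨I₁ (weaken ρ d)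
    weaken ρ (∨I₂ d)        = ∨I₂ (weaken ρ d)
    weaken ρ (∨E d e f)     = ∨E (weaken ρ d) (weaken (∷⁺ʳ _ ρ) e) (weaken (∷⁺ʳ _ ρ) f)
    weaken ρ (⇒I d)         = ⇒I (weaken (∷⁺ʳ _ ρ) d)
    weaken ρ (⇒E d e)       = ⇒E (weaken ρ d) (weaken ρ e)
    weaken ρ (∀I d)         = ∀I (weaken (map⁺ wk ρ) d)
    weaken ρ (∀E d t)       = ∀E (weaken ρ d) t
    weaken ρ (∃I t d)       = ∃I t (weaken ρ d)
    weaken ρ (∃E d e)       = ∃E (weaken ρ d) (weaken (∷⁺ʳ _ (map⁺ wk ρ)) e)
    weaken ρ (≈refl t)      = ≈refl t
    weaken ρ (≈subst F d e) = ≈subst F (weaken ρ d) (weaken ρ e)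

    -- Hypotheses are discharged one at a time by `⇒I`, so that no derivation has to be carried
    -- under a quantifier.
    cut : ∀ {Δ} {Γ Γ′ : List (Formula P Δ)} {F} → All (Ax ∣ Γ′ ⊢_) Γ → Ax ∣ Γ ⊢ F → Ax ∣ Γ′ ⊢ F
    cut []       d = weaken (λ ()) d
    cut (e ∷ es) d = ⇒E (cut es (⇒I d)) e

    module _ {Δ : Cxt} where

      infixr 4 _⨾_

      h₀ : ∀ {Γ : List (Formula P Δ)} {A} → Ax ∣ A ∷ Γ ⊢ A
      h₀ = hyp (here refl)

      h₁ : ∀ {Γ : List (Formula P Δ)} {A B} → Ax ∣ A ∷ B ∷ Γ ⊢ B
      h₁ = hyp (there (here refl))

      h₂ : ∀ {Γ : List (Formula P Δ)} {A B C} → Ax ∣ A ∷ B ∷ C ∷ Γ ⊢ C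
      h₂ = hyp (there (there (here refl)))

      h₃ : ∀ {Γ : List (Formula P Δ)} {A B C D} → Ax ∣ A ∷ B ∷ C ∷ D ∷ Γ ⊢ D
      h₃ = hyp (there (there (there (here refl))))

      _⨾_ : ∀ {Γ : List (Formula P Δ)} {A B} → Ax ∣ Γ ⊢ A → Ax ∣ A ∷ Γ ⊢ B → Ax ∣ Γ ⊢ B
      d ⨾ e = ⇒E (⇒I e) d

      shift : ∀ {Γ : List (Formula P Δ)} {A B} → Ax ∣ Γ ⊢ B → Ax ∣ A ∷ Γ ⊢ B
      shift = weaken there

    -- Elimination at the variable that an enclosing `∀I` or `∃E` has just introduced; `∃I₀` is the
    -- dual.
    ∀E₀ : ∀ {Δ s} {Γ : List (Formula P (s ∷ Δ))} F → Ax ∣ Γ ⊢ wk (∀ᶠ s F) → Ax ∣ Γ ⊢ F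
    ∀E₀ F d = ⊢-≡ (liftwk-[var] F) (∀E d (var (here refl)))

    ∃I₀ : ∀ {Δ s} {Γ : List (Formula P (s ∷ Δ))} F → Ax ∣ Γ ⊢ F → Ax ∣ Γ ⊢ wk (∃ᶠ s F)
    ∃I₀ F d = ∃I (var (here refl)) (⊢-≡ (sym (liftwk-[var] F)) d)

    ∀-closure-E : ∀ {Δ Θ} {Γ : List (Formula P Θ)} (F : Formula P Δ) → Ax ∣ Γ ⊢ wkSentence (∀-closure F) →
                  (σ : Subst Δ Θ) → Ax ∣ Γ ⊢ sub σ F
    ∀-closure-E {[]}    F d σ = ⊢-≡ (sym (ren-asSub (λ ()) F)) d
    ∀-closure-E {s ∷ Δ} F d σ =
      ⊢-≡ (sub-sub (λ { (here refl) → refl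
                      ; (there i) → trans (subTerm-renTerm (σ (there i))) (subTerm-id (σ (there i))) }) F)
          (∀E (∀-closure-E (∀ᶠ s F) d (λ i → σ (there i))) (σ (here refl)))

    -- The premise ranges over all renamings and all hypotheses because the recursion moves a
    -- variable into the context by `∀I`, which lifts the renaming and weakens the hypotheses.
    ∀-closure-I : ∀ {Δ Θ} {Γ : List (Formula P Θ)} (F : Formula P Δ) →
                  (∀ {Ξ} {Γ : List (Formula P Ξ)} (ρ : Δ ⊆ Ξ) → Ax ∣ Γ ⊢ ren ρ F) →
                  Ax ∣ Γ ⊢ wkSentence (∀-closure F)
    ∀-closure-I {[]}    F d = ⊢-≡ (trans (sym (ren-asSub {σ = λ ()} (λ ()) F)) (ren-asSub (λ ()) F)) (d (λ ()))
    ∀-closure-I {s ∷ Δ} F d = ∀-closure-I (∀ᶠ s F) (λ ρ → ∀I (d (liftRen ρ)))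

  module _ {P : Signature} {Ax : Axioms P}
           (lem : ∀ {Δ} {Γ : List (Formula P Δ)} F → Ax ∣ Γ ⊢ F ∨ᶠ ¬ᶠ F) where

    -- If `∀ᶠ s F` holds, any term is a witness; otherwise a counterexample to `F` is.
    drinker : ∀ {Δ s} {Γ : List (Formula P Δ)} (F : Formula P (s ∷ Δ)) → Ax ∣ Γ ⊢ ∃ᶠ s (F ⇒ᶠ wk (∀ᶠ s F))
    drinker {s = s} F =
      ∨E (lem (∀ᶠ s F))
        (∃I (default s) (⇒I (⊢-≡ (sym (wk-[] (∀ᶠ s F))) h₁)))
        (∨E (lem (∃ᶠ s (¬ᶠ F)))
          (∃E h₀ (∃I₀ (F ⇒ᶠ wk (∀ᶠ s F)) (⇒I (⊥E (¬E h₁ h₀)))))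
          (⊥E (¬E h₁ (∀I (∨E (lem F) h₀ (⊥E (¬E h₁ (∃I₀ (¬ᶠ F) h₀))))))))

  -- Derivations under renaming of predicate symbols

  map-comm : ∀ {A B C D : Set} {f : A → B} {g : B → D} {f′ : A → C} {g′ : C → D} →
             (∀ x → g (f x) ≡ g′ (f′ x)) → ∀ xs → map g (map f xs) ≡ map g′ (map f′ xs)
  map-comm e xs = trans (sym (map-∘ xs)) (trans (map-cong e xs) (map-∘ xs))

  module _ {P Q : Signature} {Ax : Axioms P} {Bx : Axioms Q} (h : ∀ {ar} → P ar → Q ar)
           (valid : ∀ {Δ} {Γ : List (Formula Q Δ)} {F} → Ax F → Bx ∣ Γ ⊢ mapPred h F) where

    private
      H : ∀ {Δ} → Formula P Δ → Formula Q Δ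
      H = mapPred h

      H-wk : ∀ {Δ s F} (Γ : List (Formula P Δ)) →
             Bx ∣ map H (map (wk {s = s}) Γ) ⊢ F → Bx ∣ map wk (map H Γ) ⊢ F
      H-wk {F = F} Γ = subst (Bx ∣_⊢ F) (map-comm mapPred-ren Γ)

      H-wk∷ : ∀ {Δ s F G} (Γ : List (Formula P Δ)) →
              Bx ∣ F ∷ map H (map (wk {s = s}) Γ) ⊢ G → Bx ∣ F ∷ map wk (map H Γ) ⊢ G
      H-wk∷ {F = F} {G} Γ = subst (λ Γ′ → Bx ∣ F ∷ Γ′ ⊢ G) (map-comm mapPred-ren Γ)

    -- Serves three times: to prime a derivation in `HT♯`, to erase the primes of a classical one,
    -- and to prime the result again. Asking only that images of axioms be derivable lets the axiom
    -- set change each time.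
    mapPred-sound : ∀ {Δ} {Γ : List (Formula P Δ)} {F} → Ax ∣ Γ ⊢ F → Bx ∣ map H Γ ⊢ H F
    mapPred-sound (axiom a)    = valid a
    mapPred-sound (hyp i)      = hyp (∈-map⁺ H i)
    mapPred-sound (⊥E d)       = ⊥E (mapPred-sound d)
    mapPred-sound (¬I d)       = ¬I (mapPred-sound d)
    mapPred-sound (¬E d e)     = ¬E (mapPred-sound d) (mapPred-sound e)
    mapPred-sound (∧I d e)     = ∧I (mapPred-sound d) (mapPred-sound e)
    mapPred-sound (∧E₁ d)      = ∧E₁ (mapPred-sound d)
    mapPred-sound (∧E₂ d)      = ∧E₂ (mapPred-sound d)
    mapPred-sound (∨I₁ d)      = ∨I₁ (mapPred-sound d)
    mapPred-sound (∨I₂ d)      = ∨I₂ (mapPred-sound d)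
    mapPred-sound (∨E d e f)   = ∨E (mapPred-sound d) (mapPred-sound e) (mapPred-sound f)
    mapPred-sound (⇒I d)       = ⇒I (mapPred-sound d)
    mapPred-sound (⇒E d e)     = ⇒E (mapPred-sound d) (mapPred-sound e)
    mapPred-sound {Γ = Γ} (∀I d)     = ∀I (H-wk Γ (mapPred-sound d))
    mapPred-sound (∀E {F = F} d t)   = ⊢-≡ (sym (mapPred-sub F)) (∀E (mapPred-sound d) t)
    mapPred-sound (∃I {F = F} t d)   = ∃I t (⊢-≡ (mapPred-sub F) (mapPred-sound d))
    mapPred-sound {Γ = Γ} (∃E {G = G} d e) =
      ∃E (mapPred-sound d) (⊢-≡ (mapPred-ren G) (H-wk∷ Γ (mapPred-sound e)))
    mapPred-sound (≈refl t)          = ≈refl t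
    mapPred-sound (≈subst F d e)     =
      ⊢-≡ (sym (mapPred-sub F)) (≈subst (H F) (mapPred-sound d) (⊢-≡ (mapPred-sub F) (mapPred-sound e)))

  -- Compatibility of γ and of predicate-free formulas with renaming

  module _ {P : Signature} where

    γ-ren : ∀ {Δ Θ} {ρ : Δ ⊆ Θ} (F : Formula P Δ) → γ (ren ρ F) ≡ ren ρ (γ F)
    γ-ren (atom p ts) = refl
    γ-ren (cmp c t u) = refl
    γ-ren ⊥ᶠ          = refl
    γ-ren (¬ᶠ F)      = cong ¬ᶠ_ (mapPred-ren F)
    γ-ren (F ∧ᶠ G)    = cong₂ _∧ᶠ_ (γ-ren F) (γ-ren G)
    γ-ren (F ∨ᶠ G)    = cong₂ _∨ᶠ_ (γ-ren F) (γ-ren G)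
    γ-ren (F ⇒ᶠ G)    = cong₂ _∧ᶠ_ (cong₂ _⇒ᶠ_ (γ-ren F) (γ-ren G)) (cong₂ _⇒ᶠ_ (mapPred-ren F) (mapPred-ren G))
    γ-ren (∀ᶠ s F)    = cong (∀ᶠ s) (γ-ren F)
    γ-ren (∃ᶠ s F)    = cong (∃ᶠ s) (γ-ren F)

    γ-sub : ∀ {Δ Θ} {σ : Subst Δ Θ} (F : Formula P Δ) → γ (sub σ F) ≡ sub σ (γ F)
    γ-sub (atom p ts) = refl
    γ-sub (cmp c t u) = refl
    γ-sub ⊥ᶠ          = refl
    γ-sub (¬ᶠ F)      = cong ¬ᶠ_ (mapPred-sub F)
    γ-sub (F ∧ᶠ G)    = cong₂ _∧ᶠ_ (γ-sub F) (γ-sub G)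
    γ-sub (F ∨ᶠ G)    = cong₂ _∨ᶠ_ (γ-sub F) (γ-sub G)
    γ-sub (F ⇒ᶠ G)    = cong₂ _∧ᶠ_ (cong₂ _⇒ᶠ_ (γ-sub F) (γ-sub G)) (cong₂ _⇒ᶠ_ (mapPred-sub F) (mapPred-sub G))
    γ-sub (∀ᶠ s F)    = cong (∀ᶠ s) (γ-sub F)
    γ-sub (∃ᶠ s F)    = cong (∃ᶠ s) (γ-sub F)

  module _ {P Q : Signature} {k : ∀ {ar} → P ar → Q ar} {h : ∀ {ar} → NoPred ar → P ar}
           {h′ : ∀ {ar} → NoPred ar → Q ar} where

    -- Only an atom could tell two renamings apart, and there is none; this carries standard truths
    -- between signatures.
    mapPred-NoPred : ∀ {Δ} (S : Formula NoPred Δ) →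
                     mapPred {P} {Q} k (mapPred {NoPred} {P} h S) ≡ mapPred {NoPred} {Q} h′ S
    mapPred-NoPred (atom () ts)
    mapPred-NoPred (cmp c t u) = refl
    mapPred-NoPred ⊥ᶠ          = refl
    mapPred-NoPred (¬ᶠ F)      = cong ¬ᶠ_ (mapPred-NoPred F)
    mapPred-NoPred (F ∧ᶠ G)    = cong₂ _∧ᶠ_ (mapPred-NoPred F) (mapPred-NoPred G)
    mapPred-NoPred (F ∨ᶠ G)    = cong₂ _∨ᶠ_ (mapPred-NoPred F) (mapPred-NoPred G)
    mapPred-NoPred (F ⇒ᶠ G)    = cong₂ _⇒ᶠ_ (mapPred-NoPred F) (mapPred-NoPred G)
    mapPred-NoPred (∀ᶠ s F)    = cong (∀ᶠ s) (mapPred-NoPred F)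
    mapPred-NoPred (∃ᶠ s F)    = cong (∃ᶠ s) (mapPred-NoPred F)

  -- Recovers an atom with arbitrary arguments from the general atom p(X) that occurs in `𝒜`.
  sub-vars : ∀ {Δ Θ Ξ} {σ : Subst Δ Θ} {τ : Subst Ξ Δ} (ts : Args Θ Ξ) →
             (∀ {s} (i : s ∈ Ξ) → subTerm σ (τ i) ≡ All.lookup ts i) →
             All.map (subTerm σ) (All.tabulate τ) ≡ ts
  sub-vars []       e = refl
  sub-vars (t ∷ ts) e = cong₂ _∷_ (e (here refl)) (sub-vars ts (λ i → e (there i)))

  -- From HT♯ to HT♯′

  K : Axioms σ₂′
  K = Classical HT♯′

  lem : ∀ {Δ} {Γ : List (Formula σ₂′ Δ)} F → K ∣ Γ ⊢ F ∨ᶠ ¬ᶠ F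
  lem F = axiom (excluded-middle F)

  persists : ∀ {ar} → σ₂ ar → Formula σ₂′ ar
  persists p = atom (plain p) (vars id) ⇒ᶠ atom (prime p) (vars id)

  -- Atoms are the content of `𝒜`. Negation and implication are immediate: `γ (¬ᶠ F)` is `(¬ᶠ F) ′`
  -- itself, and `γ (F ⇒ᶠ G)` has `(F ⇒ᶠ G) ′` as a conjunct.
  persist : ∀ {Δ} {Γ : List (Formula σ₂′ Δ)} F → K ∣ Γ ⊢ γ F ⇒ᶠ (F ′)
  persist (atom p ts) =
    ⊢-≡ (cong₂ _⇒ᶠ_ (cong (atom (plain p)) (sub-vars ts (λ _ → refl)))
                    (cong (atom (prime p)) (sub-vars ts (λ _ → refl))))
        (∀-closure-E (persists p) (axiom (proper (pers (persistence p)))) (All.lookup ts))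
  persist (cmp c t u) = ⇒I h₀
  persist ⊥ᶠ          = ⇒I h₀
  persist (¬ᶠ F)      = ⇒I h₀
  persist (F ∧ᶠ G)    = ⇒I (∧I (⇒E (persist F) (∧E₁ h₀)) (⇒E (persist G) (∧E₂ h₀)))
  persist (F ∨ᶠ G)    = ⇒I (∨E h₀ (∨I₁ (⇒E (persist F) h₀)) (∨I₂ (⇒E (persist G) h₀)))
  persist (F ⇒ᶠ G)    = ⇒I (∧E₂ h₀)
  persist (∀ᶠ s F)    = ⇒I (∀I (⇒E (persist F) (∀E₀ (γ F) h₀)))
  persist (∃ᶠ s F)    = ⇒I (∃E h₀ (∃I₀ (F ′) (⇒E (persist F) h₀)))

  persist-all : ∀ {Δ} (Γ : List (Formula σ₂ Δ)) → All (K ∣ map γ Γ ⊢_) (map _′ Γ)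
  persist-all []      = []
  persist-all (F ∷ Γ) = ⇒E (persist F) h₀ ∷ All.map shift (persist-all Γ)

  -- Converse to `persist` where no atom separates the two readings. It bridges the gap that `HT♯′`
  -- contains the standard truths themselves and not their images under `γ`.
  γ-NoPred : ∀ {h : ∀ {ar} → NoPred ar → σ₂ ar} {Δ} {Γ : List (Formula σ₂′ Δ)} (S : Formula NoPred Δ) →
             K ∣ Γ ⊢ (mapPred h S ′) ⇒ᶠ γ (mapPred h S)
  γ-NoPred (atom () ts)
  γ-NoPred (cmp c t u) = ⇒I h₀
  γ-NoPred ⊥ᶠ          = ⇒I h₀
  γ-NoPred (¬ᶠ F)      = ⇒I h₀
  γ-NoPred (F ∧ᶠ G)    = ⇒I (∧I (⇒E (γ-NoPred F) (∧E₁ h₀)) (⇒E (γ-NoPred G) (∧E₂ h₀)))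
  γ-NoPred (F ∨ᶠ G)    = ⇒I (∨E h₀ (∨I₁ (⇒E (γ-NoPred F) h₀)) (∨I₂ (⇒E (γ-NoPred G) h₀)))
  γ-NoPred {h} (F ⇒ᶠ G) =
    ⇒I (∧I (⇒I (⇒E (γ-NoPred G) (⇒E h₁ (⇒E (persist (mapPred h F)) h₀)))) h₀)
  γ-NoPred {h} (∀ᶠ s F) = ⇒I (∀I (⇒E (γ-NoPred F) (∀E₀ (mapPred h F ′) h₀)))
  γ-NoPred {h} (∃ᶠ s F) = ⇒I (∃E h₀ (∃I₀ (γ (mapPred h F)) (⇒E (γ-NoPred F) h₀)))

  γ-axiom : ∀ {Δ} {Γ : List (Formula σ₂′ Δ)} {F : Formula σ₂ Δ} → HT♯ F → K ∣ Γ ⊢ γ F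
  γ-axiom (hosoi F G) =
    -- Plain and primed symbols act as the two worlds, lower and upper, of a Kripke model. If `G ′`
    -- holds, the implication can fail only in the lower world, and then `γ F` holds there.
    ∨E (lem (G ′))
      (∨E (lem (γ F)) (∨I₁ h₀) (∨I₂ (∨I₁ (∧I (⇒I (⊥E (¬E h₁ h₀))) (⇒I h₂)))))
      (∨I₂ (∨I₂ h₀))
  γ-axiom {Γ = Γ} (sqht s F) =
    subst (λ A → K ∣ Γ ⊢ ∃ᶠ s ((γ F ⇒ᶠ ∀ᶠ s A) ∧ᶠ ((F ′) ⇒ᶠ (wk (∀ᶠ s F) ′)))) (sym (γ-ren F))
      (subst (λ A → K ∣ Γ ⊢ ∃ᶠ s ((γ F ⇒ᶠ wk (∀ᶠ s (γ F))) ∧ᶠ ((F ′) ⇒ᶠ A))) (sym (mapPred-ren (∀ᶠ s F)))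
        -- One term has to serve both readings. If `F ′` holds everywhere, the primed half is free
        -- and the term comes from `γ F`. Otherwise the term chosen for `F ′` makes `F ′` fail, so
        -- by persistence `γ F` fails there too.
        (∨E (lem (∀ᶠ s (F ′)))
          (∃E (drinker lem (γ F)) (∃I₀ _ (∧I h₀ (⇒I h₂))))
          (∃E (drinker lem (F ′))
            (∃I₀ _ (∧I (⇒I (⊥E (¬E h₂ (⇒E h₁ (⇒E (persist F) h₀))))) h₀)))))
  γ-axiom (std (std S v)) =
    ⊢-≡ (cong γ (mapPred-ren S))
      (⇒E (γ-NoPred (wkSentence S))
        (⊢-≡ (sym (trans (mapPred-NoPred {σ₂} {σ₂′} {prime} (wkSentence S)) (mapPred-ren S)))
          (axiom (proper (std (std S v))))))
  γ-axiom (ind i)     = axiom (proper (γind i))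
  γ-axiom (d₀ {S = S} d) = ⊢-≡ (sym (γ-ren S)) (axiom (proper (γd₀ d)))
  γ-axiom (d₁ {S = S} d) = ⊢-≡ (sym (γ-ren S)) (axiom (proper (γd₁ d)))

  prime-sound : ∀ {Δ} {Γ : List (Formula σ₂ Δ)} {F} → HT♯ ∣ Γ ⊢ F → K ∣ map _′ Γ ⊢ F ′
  prime-sound = mapPred-sound prime (λ {_} {_} {F} a → ⇒E (persist F) (γ-axiom a))

  prime-sound-γ : ∀ {Δ} {Γ : List (Formula σ₂ Δ)} {F} → HT♯ ∣ Γ ⊢ F → K ∣ map γ Γ ⊢ F ′
  prime-sound-γ {Γ = Γ} d = cut (persist-all Γ) (prime-sound d)

  γ-wk : ∀ {Δ s F} (Γ : List (Formula σ₂ Δ)) →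
         K ∣ map γ (map (wk {s = s}) Γ) ⊢ F → K ∣ map wk (map γ Γ) ⊢ F
  γ-wk {F = F} Γ = subst (K ∣_⊢ F) (map-comm γ-ren Γ)

  γ-wk∷ : ∀ {Δ s F G} (Γ : List (Formula σ₂ Δ)) →
          K ∣ F ∷ map γ (map (wk {s = s}) Γ) ⊢ G → K ∣ F ∷ map wk (map γ Γ) ⊢ G
  γ-wk∷ {F = F} {G} Γ = subst (λ Γ′ → K ∣ F ∷ Γ′ ⊢ G) (map-comm γ-ren Γ)

  γ-sound : ∀ {Δ} {Γ : List (Formula σ₂ Δ)} {F} → HT♯ ∣ Γ ⊢ F → K ∣ map γ Γ ⊢ γ F
  γ-sound (axiom a)    = γ-axiom a
  γ-sound (hyp i)      = hyp (∈-map⁺ γ i)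
  γ-sound (⊥E d)       = ⊥E (γ-sound d)
  -- The image of a negation speaks of `F ′`, so the subderivation is reread with every symbol
  -- primed; persistence supplies its primed hypotheses. The second half of the `⇒I` case arises in
  -- the same way.
  γ-sound {Γ = Γ} (¬I d) = cut (persist-all Γ) (¬I (prime-sound d))
  γ-sound (¬E {F = F} d e) = ¬E (γ-sound d) (⇒E (persist F) (γ-sound e))
  γ-sound (∧I d e)     = ∧I (γ-sound d) (γ-sound e)
  γ-sound (∧E₁ d)      = ∧E₁ (γ-sound d)
  γ-sound (∧E₂ d)      = ∧E₂ (γ-sound d)
  γ-sound (∨I₁ d)      = ∨I₁ (γ-sound d)
  γ-sound (∨I₂ d)      = ∨I₂ (γ-sound d)
  γ-sound (∨E d e f)   = ∨E (γ-sound d) (γ-sound e) (γ-sound f)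
  γ-sound (⇒I d)       = ∧I (⇒I (γ-sound d)) (prime-sound-γ (⇒I d))
  γ-sound (⇒E d e)     = ⇒E (∧E₁ (γ-sound d)) (γ-sound e)
  γ-sound {Γ = Γ} (∀I d)   = ∀I (γ-wk Γ (γ-sound d))
  γ-sound (∀E {F = F} d t) = ⊢-≡ (sym (γ-sub F)) (∀E (γ-sound d) t)
  γ-sound (∃I {F = F} t d) = ∃I t (⊢-≡ (γ-sub F) (γ-sound d))
  γ-sound {Γ = Γ} (∃E {G = G} d e) = ∃E (γ-sound d) (⊢-≡ (γ-ren G) (γ-wk∷ Γ (γ-sound e)))
  γ-sound (≈refl t)        = ≈refl t
  γ-sound (≈subst F d e)   =
    ⊢-≡ (sym (γ-sub F)) (≈subst (γ F) (γ-sound d) (⊢-≡ (γ-sub F) (γ-sound e)))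

  -- From HT♯′ to HT♯

  module _ {Δ : Cxt} {Γ : List (Formula σ₂ Δ)} where

    -- This is `hosoi` for ¬A and A: the middle disjunct ¬A → A refutes ¬A, and the outer two are
    -- ¬A.
    weak-lem : ∀ A → HT♯ ∣ Γ ⊢ ¬ᶠ A ∨ᶠ ¬ᶠ ¬ᶠ A
    weak-lem A =
      ∨E (axiom (hosoi (¬ᶠ A) A)) (∨I₁ h₀) (∨E h₀ (∨I₂ (¬I (¬E h₀ (⇒E h₁ h₀)))) (∨I₁ h₀))

    -- An instance of a standard truth, as the standard interpretation reads disjunction by De
    -- Morgan duality.
    cmp-lem : ∀ c t u → HT♯ ∣ Γ ⊢ cmp c t u ∨ᶠ ¬ᶠ cmp c t u
    cmp-lem c t u = ∀-closure-E (atomic ∨ᶠ ¬ᶠ atomic) (axiom (std lem-true)) (All.lookup {P = Term Δ} (t ∷ u ∷ []))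
      where
      atomic : ∀ {P} → Formula P (gen ∷ gen ∷ [])
      atomic = cmp c (var (here refl)) (var (there (here refl)))
      lem-true : Std (∀-closure (atomic ∨ᶠ ¬ᶠ atomic))
      lem-true = std (∀-closure (atomic ∨ᶠ ¬ᶠ atomic)) (λ _ _ (¬a , ¬¬a) → ¬¬a ¬a)

    ¬¬I : ∀ {A} → HT♯ ∣ Γ ⊢ A → HT♯ ∣ Γ ⊢ ¬ᶠ ¬ᶠ A
    ¬¬I d = ¬I (¬E h₀ (shift d))

    ¬¬-map : ∀ {A B} → HT♯ ∣ Γ ⊢ A ⇒ᶠ B → HT♯ ∣ Γ ⊢ ¬ᶠ ¬ᶠ A → HT♯ ∣ Γ ⊢ ¬ᶠ ¬ᶠ B
    ¬¬-map f d = ¬I (¬E (shift d) (¬I (¬E h₁ (⇒E (shift (shift f)) h₀))))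

  -- The translation relative to a sentence

  module Relative (C : Sentence σ₂) where

    image : ∀ {ar Δ} → σ₂′ ar → Args Δ ar → Formula σ₂ Δ
    image (plain p) ts = atom p ts
    image (prime p) ts = ¬ᶠ ¬ᶠ atom p ts

    -- A form of Friedman's A-translation: disjoining `C` to atoms is what makes `efq` provable.
    -- Double negation is how `HT♯` itself speaks of the upper world.
    N : ∀ {Δ} → Formula σ₂′ Δ → Formula σ₂ Δ
    N (atom q ts) = image q ts ∨ᶠ wkSentence C
    N (cmp c t u) = cmp c t u ∨ᶠ wkSentence C
    N ⊥ᶠ          = wkSentence C
    N (¬ᶠ A)      = N A ⇒ᶠ wkSentence C
    N (A ∧ᶠ B)    = N A ∧ᶠ N B
    N (A ∨ᶠ B)    = N A ∨ᶠ N B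
    N (A ⇒ᶠ B)    = N A ⇒ᶠ N B
    N (∀ᶠ s A)    = ∀ᶠ s (N A)
    N (∃ᶠ s A)    = ∃ᶠ s (N A)

    C-ren : ∀ {Δ Θ} {ρ : Δ ⊆ Θ} → wkSentence C ≡ ren ρ (wkSentence C)
    C-ren = sym (ren-wkSentence C)

    C-sub : ∀ {Δ Θ} {σ : Subst Δ Θ} → wkSentence C ≡ sub σ (wkSentence C)
    C-sub = sym (sub-wkSentence C)

    N-ren : ∀ {Δ Θ} {ρ : Δ ⊆ Θ} (A : Formula σ₂′ Δ) → N (ren ρ A) ≡ ren ρ (N A)
    N-ren (atom (plain p) ts) = cong (_ ∨ᶠ_) C-ren
    N-ren (atom (prime p) ts) = cong (_ ∨ᶠ_) C-ren
    N-ren (cmp c t u) = cong (_ ∨ᶠ_) C-ren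
    N-ren ⊥ᶠ          = C-ren
    N-ren (¬ᶠ A)      = cong₂ _⇒ᶠ_ (N-ren A) C-ren
    N-ren (A ∧ᶠ B)    = cong₂ _∧ᶠ_ (N-ren A) (N-ren B)
    N-ren (A ∨ᶠ B)    = cong₂ _∨ᶠ_ (N-ren A) (N-ren B)
    N-ren (A ⇒ᶠ B)    = cong₂ _⇒ᶠ_ (N-ren A) (N-ren B)
    N-ren (∀ᶠ s A)    = cong (∀ᶠ s) (N-ren A)
    N-ren (∃ᶠ s A)    = cong (∃ᶠ s) (N-ren A)

    N-sub : ∀ {Δ Θ} {σ : Subst Δ Θ} (A : Formula σ₂′ Δ) → N (sub σ A) ≡ sub σ (N A)
    N-sub (atom (plain p) ts) = cong (_ ∨ᶠ_) C-sub
    N-sub (atom (prime p) ts) = cong (_ ∨ᶠ_) C-sub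
    N-sub (cmp c t u) = cong (_ ∨ᶠ_) C-sub
    N-sub ⊥ᶠ          = C-sub
    N-sub (¬ᶠ A)      = cong₂ _⇒ᶠ_ (N-sub A) C-sub
    N-sub (A ∧ᶠ B)    = cong₂ _∧ᶠ_ (N-sub A) (N-sub B)
    N-sub (A ∨ᶠ B)    = cong₂ _∨ᶠ_ (N-sub A) (N-sub B)
    N-sub (A ⇒ᶠ B)    = cong₂ _⇒ᶠ_ (N-sub A) (N-sub B)
    N-sub (∀ᶠ s A)    = cong (∀ᶠ s) (N-sub A)
    N-sub (∃ᶠ s A)    = cong (∃ᶠ s) (N-sub A)

    N-∀-closure : ∀ {Δ} (A : Formula σ₂′ Δ) → N (∀-closure A) ≡ ∀-closure (N A)
    N-∀-closure {[]}    A = refl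
    N-∀-closure {s ∷ Δ} A = N-∀-closure (∀ᶠ s A)

    efq : ∀ {Δ} {Γ : List (Formula σ₂ Δ)} A → HT♯ ∣ Γ ⊢ wkSentence C ⇒ᶠ N A
    efq (atom q ts) = ⇒I (∨I₂ h₀)
    efq (cmp c t u) = ⇒I (∨I₂ h₀)
    efq ⊥ᶠ          = ⇒I h₀
    efq (¬ᶠ A)      = ⇒I (⇒I h₁)
    efq (A ∧ᶠ B)    = ⇒I (∧I (⇒E (efq A) h₀) (⇒E (efq B) h₀))
    efq (A ∨ᶠ B)    = ⇒I (∨I₁ (⇒E (efq A) h₀))
    efq (A ⇒ᶠ B)    = ⇒I (⇒I (⇒E (efq B) h₁))
    efq (∀ᶠ s A)    = ⇒I (∀I (⇒E (efq A) (⊢-≡ (sym C-ren) h₀)))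
    efq (∃ᶠ s A)    =
      ⇒I (∃I t (⇒E (∀E (∀I {F = wk (wkSentence C) ⇒ᶠ N A} (⇒I (⇒E (efq A) (⊢-≡ (sym C-ren) h₀)))) t)
                   -- The implication is generalised by `∀I` and then instantiated at `t`, since a
                   -- call of `efq` at the instance of `A` would not be structurally recursive.
                   (⊢-≡ (sym (wk-[] (wkSentence C))) h₀)))
      where t = default s

    -- Mutual because negation and implication exchange the two bounds. Intuitionistically, double
    -- negation fails to commute with ∨, ∃ and ∀; `weak-lem` repairs the first and `sqht` the
    -- quantifiers.
    prime⁺ : ∀ {Δ} {Γ : List (Formula σ₂ Δ)} A → HT♯ ∣ Γ ⊢ ¬ᶠ ¬ᶠ A ⇒ᶠ N (A ′)
    prime⁻ : ∀ {Δ} {Γ : List (Formula σ₂ Δ)} A → HT♯ ∣ Γ ⊢ N (A ′) ⇒ᶠ ¬ᶠ ¬ᶠ A ∨ᶠ wkSentence C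

    prime⁺ (atom p ts) = ⇒I (∨I₁ h₀)
    prime⁺ (cmp c t u) = ⇒I (∨E (cmp-lem c t u) (∨I₁ h₀) (⊥E (¬E h₁ h₀)))
    prime⁺ ⊥ᶠ          = ⇒I (⊥E (¬E h₀ (¬I h₀)))
    prime⁺ (¬ᶠ A)      = ⇒I (⇒I (∨E (⇒E (prime⁻ A) h₀) (⊥E (¬E h₂ h₀)) h₀))
    prime⁺ (A ∧ᶠ B)    = ⇒I (∧I (⇒E (prime⁺ A) (¬¬-map (⇒I (∧E₁ h₀)) h₀))
                                (⇒E (prime⁺ B) (¬¬-map (⇒I (∧E₂ h₀)) h₀)))
    prime⁺ (A ∨ᶠ B)    =
      ⇒I (∨E (weak-lem A)
        (∨I₂ (⇒E (prime⁺ B) (¬¬-map (⇒I (∨E h₀ (⊥E (¬E h₂ h₀)) h₀)) h₁)))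
        (∨I₁ (⇒E (prime⁺ A) h₀)))
    prime⁺ (A ⇒ᶠ B)    =
      ⇒I (⇒I (∨E (⇒E (prime⁻ A) h₀)
        (⇒E (prime⁺ B) (¬I (¬E h₃ (¬I (¬E h₂ (¬I (¬E h₂ (⇒E h₁ h₀))))))))
        (⇒E (efq (B ′)) h₀)))
    prime⁺ (∀ᶠ s A)    = ⇒I (∀I (⇒E (prime⁺ A) (¬¬-map (⇒I (∀E₀ A h₀)) h₀)))
    prime⁺ (∃ᶠ s A)    =
      -- For ¬A, `sqht` gives a term at which ¬A would entail the refuted ∀ ¬A; hence ¬¬A holds at
      -- that term.
      ⇒I (¬I {F = ∀ᶠ s (¬ᶠ A)} (¬E h₁ (¬I (∃E h₀ (¬E (∀E₀ (¬ᶠ A) h₂) h₀)))) ⨾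
          ∃E (axiom (sqht s (¬ᶠ A))) (∃I₀ (N (A ′)) (⇒E (prime⁺ A) (¬I (¬E h₂ (⇒E h₁ h₀))))))

    prime⁻ (atom p ts) = ⇒I h₀
    prime⁻ (cmp c t u) = ⇒I (∨E h₀ (∨I₁ (¬¬I h₀)) (∨I₂ h₀))
    prime⁻ ⊥ᶠ          = ⇒I (∨I₂ h₀)
    prime⁻ (¬ᶠ A)      = ⇒I (∨E (weak-lem A) (∨I₁ (¬¬I h₀)) (∨I₂ (⇒E h₁ (⇒E (prime⁺ A) h₀))))
    prime⁻ (A ∧ᶠ B)    =
      ⇒I (∨E (⇒E (prime⁻ A) (∧E₁ h₀))
        (∨E (⇒E (prime⁻ B) (∧E₂ h₁))
          (∨I₁ (¬I (¬E h₂ (¬I (¬E h₂ (¬I (¬E h₂ (∧I h₁ h₀))))))))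
          (∨I₂ h₀))
        (∨I₂ h₀))
    prime⁻ (A ∨ᶠ B)    =
      ⇒I (∨E h₀
        (∨E (⇒E (prime⁻ A) h₀) (∨I₁ (¬¬-map (⇒I (∨I₁ h₀)) h₀)) (∨I₂ h₀))
        (∨E (⇒E (prime⁻ B) h₀) (∨I₁ (¬¬-map (⇒I (∨I₂ h₀)) h₀)) (∨I₂ h₀)))
    prime⁻ (A ⇒ᶠ B)    =
      ⇒I (∨E (weak-lem A)
        (∨I₁ (¬¬I (⇒I (⊥E (¬E h₁ h₀)))))
        (∨E (⇒E (prime⁻ B) (⇒E h₁ (⇒E (prime⁺ A) h₀)))
          (∨I₁ (¬¬-map (⇒I (⇒I h₁)) h₀))
          (∨I₂ h₀)))
    prime⁻ (∀ᶠ s A)    =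
      -- The term from `sqht` is the worst case for `A`: a decision between ¬¬A and `C` there
      -- decides for all values at once. The universal case of `γ⁻` uses the same device.
      ⇒I (∃E (axiom (sqht s A))
        (∨E (⇒E (prime⁻ A) (∀E₀ (N (A ′)) h₁))
          (∨I₁ (¬¬-map h₁ h₀))
          (∨I₂ (⊢-≡ C-ren h₀))))
    prime⁻ (∃ᶠ s A)    =
      ⇒I (∃E h₀
        (∨E (⇒E (prime⁻ A) h₀)
          (∨I₁ (¬¬-map (⇒I (∃I₀ A h₀)) h₀))
          (∨I₂ (⊢-≡ C-ren h₀))))

    -- Mutual for the same reason as `prime⁺` and `prime⁻`, to which negations and the primed halves
    -- of implications are delegated.
    γ⁺ : ∀ {Δ} {Γ : List (Formula σ₂ Δ)} A → HT♯ ∣ Γ ⊢ A ⇒ᶠ N (γ A)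
    γ⁻ : ∀ {Δ} {Γ : List (Formula σ₂ Δ)} A → HT♯ ∣ Γ ⊢ N (γ A) ⇒ᶠ A ∨ᶠ wkSentence C

    γ⁺ (atom p ts) = ⇒I (∨I₁ h₀)
    γ⁺ (cmp c t u) = ⇒I (∨I₁ h₀)
    γ⁺ ⊥ᶠ          = ⇒I (⊥E h₀)
    γ⁺ (¬ᶠ A)      = ⇒I (⇒I (∨E (⇒E (prime⁻ A) h₀) (⊥E (¬E h₀ h₂)) h₀))
    γ⁺ (A ∧ᶠ B)    = ⇒I (∧I (⇒E (γ⁺ A) (∧E₁ h₀)) (⇒E (γ⁺ B) (∧E₂ h₀)))
    γ⁺ (A ∨ᶠ B)    = ⇒I (∨E h₀ (∨I₁ (⇒E (γ⁺ A) h₀)) (∨I₂ (⇒E (γ⁺ B) h₀)))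
    γ⁺ (A ⇒ᶠ B)    =
      ⇒I (∧I (⇒I (∨E (⇒E (γ⁻ A) h₀) (⇒E (γ⁺ B) (⇒E h₂ h₀)) (⇒E (efq (γ B)) h₀)))
             (⇒E (prime⁺ (A ⇒ᶠ B)) (¬¬I h₀)))
    γ⁺ (∀ᶠ s A)    = ⇒I (∀I (⇒E (γ⁺ A) (∀E₀ A h₀)))
    γ⁺ (∃ᶠ s A)    = ⇒I (∃E h₀ (∃I₀ (N (γ A)) (⇒E (γ⁺ A) h₀)))

    γ⁻ (atom p ts) = ⇒I h₀
    γ⁻ (cmp c t u) = ⇒I h₀
    γ⁻ ⊥ᶠ          = ⇒I (∨I₂ h₀)
    γ⁻ (¬ᶠ A)      = ⇒I (∨E (weak-lem A) (∨I₁ h₀) (∨I₂ (⇒E h₁ (⇒E (prime⁺ A) h₀))))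
    γ⁻ (A ∧ᶠ B)    =
      ⇒I (∨E (⇒E (γ⁻ A) (∧E₁ h₀))
        (∨E (⇒E (γ⁻ B) (∧E₂ h₁)) (∨I₁ (∧I h₁ h₀)) (∨I₂ h₀))
        (∨I₂ h₀))
    γ⁻ (A ∨ᶠ B)    =
      ⇒I (∨E h₀
        (∨E (⇒E (γ⁻ A) h₀) (∨I₁ (∨I₁ h₀)) (∨I₂ h₀))
        (∨E (⇒E (γ⁻ B) h₀) (∨I₁ (∨I₂ h₀)) (∨I₂ h₀)))
    γ⁻ (A ⇒ᶠ B)    =
      -- The cases are A, A → B and ¬B. In the last one the primed conjunct of `γ (A ⇒ᶠ B)` leaves
      -- only ¬A, which gives A → B, or `C`.
      ⇒I (∨E (axiom (hosoi A B))
        (∨E (⇒E (γ⁻ B) (⇒E (∧E₁ h₁) (⇒E (γ⁺ A) h₀))) (∨I₁ (⇒I h₁)) (∨I₂ h₀))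
        (∨E h₀
          (∨I₁ h₀)
          (∨E (weak-lem A)
            (∨I₁ (⇒I (⊥E (¬E h₁ h₀))))
            (∨E (⇒E (prime⁻ B) (⇒E (∧E₂ h₃) (⇒E (prime⁺ A) h₀)))
              (⊥E (¬E h₀ h₂))
              (∨I₂ h₀)))))
    γ⁻ (∀ᶠ s A)    =
      ⇒I (∃E (axiom (sqht s A))
        (∨E (⇒E (γ⁻ A) (∀E₀ (N (γ A)) h₁)) (∨I₁ (⇒E h₁ h₀)) (∨I₂ (⊢-≡ C-ren h₀))))
    γ⁻ (∃ᶠ s A)    =
      ⇒I (∃E h₀ (∨E (⇒E (γ⁻ A) h₀) (∨I₁ (∃I₀ A h₀)) (∨I₂ (⊢-≡ C-ren h₀))))

    module _ {Bx : Axioms σ₂′} (D : Sentence σ₂)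
             (valid : ∀ {Δ} {Γ : List (Formula σ₂ Δ)} {A} → wkSentence D ∈ Γ → Bx A → HT♯ ∣ Γ ⊢ N A) where

      -- `D` is a hypothesis on which the reading of the axioms may depend; being closed, it
      -- survives weakening under quantifiers. `Γ′` is any list with `D` and the images of `Γ`, so
      -- that it can grow along with `Γ`.
      N-sound : ∀ {Δ Γ} {Γ′ : List (Formula σ₂ Δ)} {A} → Bx ∣ Γ ⊢ A →
                wkSentence D ∈ Γ′ → map N Γ ⊆ Γ′ → HT♯ ∣ Γ′ ⊢ N A

      N-sound-wk : ∀ {Δ s Γ} {Γ′ : List (Formula σ₂ Δ)} {A} → Bx ∣ map wk Γ ⊢ A →
                   wkSentence D ∈ Γ′ → map N Γ ⊆ Γ′ → HT♯ ∣ map (wk {s = s}) Γ′ ⊢ N A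

      N-sound-wk∷ : ∀ {Δ s Γ} {Γ′ : List (Formula σ₂ Δ)} {A B} → Bx ∣ A ∷ map wk Γ ⊢ B →
                    wkSentence D ∈ Γ′ → map N Γ ⊆ Γ′ → HT♯ ∣ N A ∷ map (wk {s = s}) Γ′ ⊢ N B

      N-sound (axiom a)      i ρ = valid i a
      N-sound (hyp j)        i ρ = hyp (ρ (∈-map⁺ N j))
      N-sound (⊥E {F = A} d) i ρ = ⇒E (efq A) (N-sound d i ρ)
      N-sound (¬I d)         i ρ = ⇒I (N-sound d (there i) (∷⁺ʳ _ ρ))
      N-sound (¬E d e)       i ρ = ⇒E (N-sound d i ρ) (N-sound e i ρ)
      N-sound (∧I d e)       i ρ = ∧I (N-sound d i ρ) (N-sound e i ρ)
      N-sound (∧E₁ d)        i ρ = ∧E₁ (N-sound d i ρ)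
      N-sound (∧E₂ d)        i ρ = ∧E₂ (N-sound d i ρ)
      N-sound (∨I₁ d)        i ρ = ∨I₁ (N-sound d i ρ)
      N-sound (∨I₂ d)        i ρ = ∨I₂ (N-sound d i ρ)
      N-sound (∨E d e f)     i ρ =
        ∨E (N-sound d i ρ) (N-sound e (there i) (∷⁺ʳ _ ρ)) (N-sound f (there i) (∷⁺ʳ _ ρ))
      N-sound (⇒I d)         i ρ = ⇒I (N-sound d (there i) (∷⁺ʳ _ ρ))
      N-sound (⇒E d e)       i ρ = ⇒E (N-sound d i ρ) (N-sound e i ρ)
      N-sound (∀I d)         i ρ = ∀I (N-sound-wk d i ρ)
      N-sound (∀E {F = A} d t) i ρ = ⊢-≡ (sym (N-sub A)) (∀E (N-sound d i ρ) t)
      N-sound (∃I {F = A} t d) i ρ = ∃I t (⊢-≡ (N-sub A) (N-sound d i ρ))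
      N-sound (∃E {G = B} d e) i ρ = ∃E (N-sound d i ρ) (⊢-≡ (N-ren B) (N-sound-wk∷ e i ρ))
      N-sound (≈refl t)      i ρ = ∨I₁ (≈refl t)
      N-sound (≈subst A {t} {u} d e) i ρ =
        -- An equation is read as t = u or `C`; in the second case `efq` gives the goal.
        ∨E (N-sound d i ρ)
          (⊢-≡ (sym (N-sub A)) (≈subst (N A) h₀ (shift (⊢-≡ (N-sub A) (N-sound e i ρ)))))
          (⇒E (efq (A [ u ])) h₀)

      N-sound-wk {Γ = Γ} {Γ′} d i ρ =
        N-sound d (subst (_∈ map wk Γ′) (ren-wkSentence D) (∈-map⁺ wk i))
          (subst (_⊆ map wk Γ′) (sym (map-comm N-ren Γ)) (map⁺ wk ρ))

      N-sound-wk∷ {Γ = Γ} {Γ′} d i ρ =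
        N-sound d (there (subst (_∈ map wk Γ′) (ren-wkSentence D) (∈-map⁺ wk i)))
          (∷⁺ʳ _ (subst (_⊆ map wk Γ′) (sym (map-comm N-ren Γ)) (map⁺ wk ρ)))

    N-axiom : ∀ {Δ} {Γ : List (Formula σ₂ Δ)} {A} → wkSentence (¬ᶠ ¬ᶠ C) ∈ Γ → K A → HT♯ ∣ Γ ⊢ N A
    N-axiom i (excluded-middle A) =
      ∨E (axiom (hosoi (N A) (wkSentence C)))
        (∨I₁ h₀)
        (∨E h₀ (∨I₂ h₀) (⊥E (¬E (hyp (there (there i))) h₀)))
    N-axiom i (proper (pers (persistence p))) =
      ⊢-≡ (sym (trans (N-ren (∀-closure (persists p))) (cong wkSentence (N-∀-closure (persists p)))))
        (∀-closure-I (N (persists p)) (λ ρ → ⇒I (∨E h₀ (∨I₁ (¬¬I h₀)) (∨I₂ h₀))))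
    N-axiom i (proper (γind {F = F} a)) = ⇒E (γ⁺ F) (axiom (ind a))
    -- A sentence without predicate symbols is its own primed version, so `prime⁺` applies.
    N-axiom i (proper (std (std S v))) =
      ⊢-≡ (cong N (trans (mapPred-ren (mapPred {Q = σ₂} (λ ()) S))
                         (cong wkSentence (mapPred-NoPred {σ₂} {σ₂′} {prime} S))))
        (⇒E (prime⁺ (wkSentence (mapPred (λ ()) S))) (¬¬I (axiom (std (std S v)))))
    N-axiom i (proper (γd₀ {S = S} a)) = ⊢-≡ (cong N (γ-ren S)) (⇒E (γ⁺ (wkSentence S)) (axiom (d₀ a)))
    N-axiom i (proper (γd₁ {S = S} a)) = ⊢-≡ (cong N (γ-ren S)) (⇒E (γ⁺ (wkSentence S)) (axiom (d₁ a)))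

  -- Erasing primes and reflecting implications

  forget : ∀ {ar} → σ₂′ ar → σ₂ ar
  forget (plain p) = p
  forget (prime p) = p

  erase : ∀ {Δ} → Formula σ₂′ Δ → Formula σ₂ Δ
  erase = mapPred forget

  erase-prime : ∀ {Δ} (A : Formula σ₂ Δ) → erase (A ′) ≡ A
  erase-prime (atom p ts) = refl
  erase-prime (cmp c t u) = refl
  erase-prime ⊥ᶠ          = refl
  erase-prime (¬ᶠ A)      = cong ¬ᶠ_ (erase-prime A)
  erase-prime (A ∧ᶠ B)    = cong₂ _∧ᶠ_ (erase-prime A) (erase-prime B)
  erase-prime (A ∨ᶠ B)    = cong₂ _∨ᶠ_ (erase-prime A) (erase-prime B)
  erase-prime (A ⇒ᶠ B)    = cong₂ _⇒ᶠ_ (erase-prime A) (erase-prime B)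
  erase-prime (∀ᶠ s A)    = cong (∀ᶠ s) (erase-prime A)
  erase-prime (∃ᶠ s A)    = cong (∃ᶠ s) (erase-prime A)

  -- Once p and p′ are identified, the two conjuncts of the image of an implication say the same.
  erase-γ⁺ : ∀ {Δ} {Γ : List (Formula σ₂ Δ)} A → HT♯ ∣ Γ ⊢ A ⇒ᶠ erase (γ A)
  erase-γ⁻ : ∀ {Δ} {Γ : List (Formula σ₂ Δ)} A → HT♯ ∣ Γ ⊢ erase (γ A) ⇒ᶠ A

  erase-γ⁺ (atom p ts) = ⇒I h₀
  erase-γ⁺ (cmp c t u) = ⇒I h₀
  erase-γ⁺ ⊥ᶠ          = ⇒I h₀
  erase-γ⁺ (¬ᶠ A)      = ⇒I (⊢-≡ (cong ¬ᶠ_ (sym (erase-prime A))) h₀)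
  erase-γ⁺ (A ∧ᶠ B)    = ⇒I (∧I (⇒E (erase-γ⁺ A) (∧E₁ h₀)) (⇒E (erase-γ⁺ B) (∧E₂ h₀)))
  erase-γ⁺ (A ∨ᶠ B)    = ⇒I (∨E h₀ (∨I₁ (⇒E (erase-γ⁺ A) h₀)) (∨I₂ (⇒E (erase-γ⁺ B) h₀)))
  erase-γ⁺ (A ⇒ᶠ B)    =
    ⇒I (∧I (⇒I (⇒E (erase-γ⁺ B) (⇒E h₁ (⇒E (erase-γ⁻ A) h₀))))
           (⊢-≡ (sym (erase-prime (A ⇒ᶠ B))) h₀))
  erase-γ⁺ (∀ᶠ s A)    = ⇒I (∀I (⇒E (erase-γ⁺ A) (∀E₀ A h₀)))
  erase-γ⁺ (∃ᶠ s A)    = ⇒I (∃E h₀ (∃I₀ (erase (γ A)) (⇒E (erase-γ⁺ A) h₀)))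

  erase-γ⁻ (atom p ts) = ⇒I h₀
  erase-γ⁻ (cmp c t u) = ⇒I h₀
  erase-γ⁻ ⊥ᶠ          = ⇒I h₀
  erase-γ⁻ (¬ᶠ A)      = ⇒I (⊢-≡ (cong ¬ᶠ_ (erase-prime A)) h₀)
  erase-γ⁻ (A ∧ᶠ B)    = ⇒I (∧I (⇒E (erase-γ⁻ A) (∧E₁ h₀)) (⇒E (erase-γ⁻ B) (∧E₂ h₀)))
  erase-γ⁻ (A ∨ᶠ B)    = ⇒I (∨E h₀ (∨I₁ (⇒E (erase-γ⁻ A) h₀)) (∨I₂ (⇒E (erase-γ⁻ B) h₀)))
  erase-γ⁻ (A ⇒ᶠ B)    = ⇒I (⊢-≡ (erase-prime (A ⇒ᶠ B)) (∧E₂ h₀))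
  erase-γ⁻ (∀ᶠ s A)    = ⇒I (∀I (⇒E (erase-γ⁻ A) (∀E₀ (erase (γ A)) h₀)))
  erase-γ⁻ (∃ᶠ s A)    = ⇒I (∃E h₀ (∃I₀ A (⇒E (erase-γ⁻ A) h₀)))

  -- The double negation is there for excluded middle; persistence becomes p → p, and the other
  -- axioms become theorems of `HT♯`.
  erase-axiom : ∀ {Δ} {Γ : List (Formula σ₂ Δ)} {A} → K A → HT♯ ∣ Γ ⊢ ¬ᶠ ¬ᶠ erase A
  erase-axiom (excluded-middle A) = ¬I (¬E h₀ (∨I₂ (¬I (¬E h₁ (∨I₁ h₀)))))
  erase-axiom (proper (pers (persistence p))) =
    ¬¬I (⊢-≡ (sym (trans (mapPred-ren (∀-closure (persists p))) (cong wkSentence (mapPred-∀-closure (persists p)))))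
          (∀-closure-I (erase (persists p)) (λ ρ → ⇒I h₀)))
  erase-axiom (proper (γind {F = F} a)) = ¬¬I (⇒E (erase-γ⁺ F) (axiom (ind a)))
  erase-axiom (proper (std (std S v))) =
    ¬¬I (⊢-≡ (sym (trans (mapPred-ren (mapPred {Q = σ₂′} (λ ()) S))
                         (cong wkSentence (mapPred-NoPred {σ₂′} {σ₂} {forget} S))))
          (axiom (std (std S v))))
  erase-axiom (proper (γd₀ {S = S} a)) =
    ¬¬I (⊢-≡ (cong erase (γ-ren S)) (⇒E (erase-γ⁺ (wkSentence S)) (axiom (d₀ a))))
  erase-axiom (proper (γd₁ {S = S} a)) =
    ¬¬I (⊢-≡ (cong erase (γ-ren S)) (⇒E (erase-γ⁺ (wkSentence S)) (axiom (d₁ a))))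

  -- Makes formulas known only up to double negation into axioms, so that the erased derivation can
  -- be kept intact; ¬¬A is exactly what `prime⁺` asks for.
  data Stable : Axioms σ₂ where
    stable : ∀ {Δ} {A : Formula σ₂ Δ} → (∀ {Γ} → HT♯ ∣ Γ ⊢ ¬ᶠ ¬ᶠ A) → Stable A

  -- Only the plain half of `γ (F ⇒ᶠ G)` is given, so the primed information has to be extracted
  -- from the derivation `d` itself. With `G` for `C`, both disjuncts delivered by `γ⁻ G` are the
  -- goal.
  γ-reflect : ∀ F G → HT♯′ ⊢ᶜ (γ F ⇒ᶠ γ G) → HT♯ ⊢ (F ⇒ᶠ G)
  γ-reflect F G d = ⇒I (⊢-≡ (sym (wkSentence-id (¬ᶠ ¬ᶠ G))) ¬¬G ⨾
    ∨E (⇒E (γ⁻ G) (⇒E (N-sound (¬ᶠ ¬ᶠ G) N-axiom d (here refl) (λ ())) (⇒E (γ⁺ F) h₁)))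
      h₀
      (⊢-≡ (wkSentence-id G) h₀))
    where
    open Relative G

    data Primeable : Axioms σ₂′ where
      primeable : ∀ {Δ} {A : Formula σ₂ Δ} → Stable A → Primeable (A ′)

    primeable-axiom : ∀ {Δ} {Γ : List (Formula σ₂ Δ)} {A} →
                      wkSentence (¬ᶠ ⊥ᶠ) ∈ Γ → Primeable A → HT♯ ∣ Γ ⊢ N A
    primeable-axiom i (primeable {A = A} (stable s)) = ⇒E (prime⁺ A) s

    erased : Stable ⊢ erase (γ F ⇒ᶠ γ G)
    erased = mapPred-sound forget (λ a → axiom (stable (erase-axiom a))) d

    N-erased : HT♯ ∣ ¬ᶠ ⊥ᶠ ∷ [] ⊢ N (erase (γ F ⇒ᶠ γ G) ′)
    N-erased =
      -- The provable sentence ¬⊥ takes the place of `D`; it is cut away in `¬¬G`.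
      N-sound (¬ᶠ ⊥ᶠ) (λ {_} {_} {A} → primeable-axiom {A = A})
        (mapPred-sound prime (λ a → axiom (primeable a)) erased) (here refl) (λ ())

    ¬¬G : HT♯ ∣ F ∷ [] ⊢ ¬ᶠ ¬ᶠ G
    ¬¬G =
      -- Both outcomes of `prime⁻` yield ¬¬G, the second because `C` is `G`.
      ∨E (⇒E (prime⁻ (erase (γ G)))
           (⇒E (cut (¬I h₀ ∷ []) N-erased) (⇒E (prime⁺ (erase (γ F))) (¬¬I (⇒E (erase-γ⁺ F) h₀)))))
        (¬¬-map (erase-γ⁻ G) h₀)
        (¬¬I (⊢-≡ (wkSentence-id G) h₀))

theorem3 : (𝒱 : Vocabulary) → let open Language 𝒱 in
    (F G : Sentence σ₂) → (HT♯ ⊢ (F ⇔ᶠ G)) ⇔ (HT♯′ ⊢ᶜ (γ F ⇔ᶠ γ G))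
theorem3 𝒱 F G =
  -- The image of the equivalence pairs each implication with its primed version; the projections
  -- keep the plain ones.
  mk⇔ (λ d → ∧I (∧E₁ (∧E₁ (γ-sound d))) (∧E₁ (∧E₂ (γ-sound d))))
      (λ d → ∧I (γ-reflect F G (∧E₁ d)) (γ-reflect G F (∧E₂ d)))
  where
  open Language 𝒱
  open Calculus 𝒱
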